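{- For $u,v,n \in \mathbb{N}$, let $C_3(u,v,n)$ denote the number of partitions of $n$ into $u$ distinct parts congruent to $1$ modulo $3$ and $v$ distinct parts congruent to $2$ modulo $3$ (all parts distinct). Let $D_3(u,v,n)$ denote the number of overpartitions $\lambda_1 + \cdots + \lambda_s$ of $n$ such that only parts congruent to $\pm 1 \pmod 6$ can be overlined, $\overline{1}$ is not a part, $u$ equals the number of non-overlined parts congruent to $0$ or $1$ modulo $3$ plus twice the number of overlined parts congruent to $5$ modulo $6$, and $v$ equals the number of non-overlined parts congruent to $0$ or $2$ modulo $3$ plus twice the number of overlined parts congruent to $1$ modulo $6$, and satisfying, for all $1\le i<s$, $$\lambda_i - \lambda_{i+1} \geq \begin{cases} 4 + \chi(\overline{\lambda_{i+1}}) & \text{if } \lambda_{i} \equiv 1, 2, 3, 5 \pmod 6 \text{ and } \lambda_i \text{ is not overlined} , \\ 5 + \chi(\overline{\lambda_{i+1}}) & \text{if } \lambda_{i} \equiv 0, 4 \pmod 6, \\ 6 + \chi(\overline{\lambda_{i+1}}) & \text{if } \lambda_{i} \equiv 1, 5 \pmod 6 \text{ and } \lambda_i \text{ is overlined}, \end{cases}$$ where $\chi(\overline{\lambda_{i+1}})=1$ if $\lambda_{i+1}$ is overlined and $0$ otherwise. Then $C_3(u,v,n)=D_3(u,v,n)$ for all $u,v,n\in\mathbb{N}$.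
   Context: An overpartition of $n$ is a partition of $n$ (into positive integers, listed in non-increasing order) in which the first occurrence of each part value may be overlined; an overlined part $\overline{m}$ has value $m$. -}

module Defs where

open import Data.Bool using (Bool; true; false; T; if_then_else_)
open import Data.Bool.Properties using (T?)
import Data.Bool.Properties as Bool
open import Data.List using (List; []; _∷_; length; map; filter; upTo; cartesianProductWith)
open import Data.List.Properties using (length-map; ∷-injective)
open import Data.List.Membership.Propositional using (_∈_; _∉_)
open import Data.List.Membership.Propositional.Properties
  using (∈-cartesianProductWith⁺; ∈-upTo⁺; ∈-filter⁺; ∈-filter⁻)
import Data.List.Membership.DecPropositional as DecMembership
open import Data.List.Relation.Unary.All using (All; []; _∷_; all?)
import Data.List.Relation.Unary.All as All
import Data.List.Relation.Unary.All.Properties as AllP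
open import Data.List.Relation.Unary.AllPairs using ([]; _∷_)
open import Data.List.Relation.Unary.Any using (here; there)
open import Data.List.Relation.Unary.Linked using (Linked; linked?)
open import Data.List.Relation.Unary.Unique.Propositional using (Unique)
import Data.List.Relation.Unary.Unique.Propositional.Properties as UniqueP
open import Data.List.Relation.Unary.Unique.DecPropositional using (unique?)
open import Data.Nat using (ℕ; zero; suc; _+_; _*_; _∸_; _%_; _≤_; _≥_; _<_; z≤n; s≤s; _≟_; _≥?_; _<?_)
open import Data.Nat.ListAction using (sum)
open import Data.Nat.Properties using (+-mono-≤; ≤-trans; m≤m+n; m≤n+m)
open import Data.Product using (∃; _×_; _,_; proj₂)
open import Function using (_∘_; _⇔_; mk⇔)
open import Relation.Binary.Definitions using (DecidableEquality)
open import Relation.Binary.PropositionalEquality using (_≡_; refl; subst)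
open import Relation.Nullary using (¬_; Dec)
open import Relation.Nullary.Decidable using (_×-dec_; _→-dec_; ¬?; map′)
open import Relation.Unary using (Decidable)

private
  variable
    A : Set

_∈?_ : (x : ℕ) (xs : List ℕ) → Dec (x ∈ xs)
_∈?_ = DecMembership._∈?_ _≟_

#[_] : {P : A → Set} → Decidable P → List A → ℕ
#[ P? ] xs = length (filter P? xs)

listsOver : List A → ℕ → List (List A)
listsOver as zero    = [] ∷ []
listsOver as (suc k) = [] ∷ cartesianProductWith _∷_ as (listsOver as k)

HasSize : (A → Set) → ℕ → Set
HasSize P k = ∃ λ xs → Unique xs × (∀ x → x ∈ xs ⇔ P x) × length xs ≡ k

IsPartition : ℕ → List ℕ → Set
IsPartition n λs = Linked _≥_ λs × All (0 <_) λs × sum λs ≡ n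

isPartition? : ∀ n → Decidable (IsPartition n)
isPartition? n λs = linked? _≥?_ λs ×-dec all? (0 <?_) λs ×-dec sum λs ≟ n

InC₃ : ℕ → ℕ → ℕ → List ℕ → Set
InC₃ u v n λs =
    IsPartition n λs
  × Unique λs
  × All (λ x → x % 3 ∈ 1 ∷ 2 ∷ []) λs
  × u ≡ #[ (λ x → x % 3 ≟ 1) ] λs
  × v ≡ #[ (λ x → x % 3 ≟ 2) ] λs

inC₃? : ∀ u v n → Decidable (InC₃ u v n)
inC₃? u v n λs =
  isPartition? n λs
  ×-dec unique? _≟_ λs
  ×-dec all? (λ x → (x % 3) ∈? (1 ∷ 2 ∷ [])) λs
  ×-dec u ≟ _
  ×-dec v ≟ _

-- listsOver ranges over the lists of length at most n with entries at most n,
-- among which are all partitions of n; see C₃-size.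
C₃ : ℕ → ℕ → ℕ → ℕ
C₃ u v n = #[ inC₃? u v n ] (listsOver (upTo (suc n)) n)

record Part : Set where
  constructor part
  field
    value     : ℕ
    overlined : Bool

open Part public

Overlined : Part → Set
Overlined x = T (overlined x)

overlined? : Decidable Overlined
overlined? x = T? (overlined x)

_≟ᴾ_ : DecidableEquality Part
part a b ≟ᴾ part c d =
  map′ (λ { (refl , refl) → refl }) (λ { refl → refl , refl })
       (a ≟ c ×-dec b Bool.≟ d)

-- In a non-increasing list equal values are adjacent, so "only the first
-- occurrence of a value may be overlined" says that a part following a part
-- of the same value is not overlined.
IsOverpartition : ℕ → List Part → Set
IsOverpartition n λs =
    IsPartition n (map value λs)
  × Linked (λ x y → value x ≡ value y → ¬ Overlined y) λs

isOverpartition? : ∀ n → Decidable (IsOverpartition n)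
isOverpartition? n λs =
  isPartition? n (map value λs)
  ×-dec linked? (λ x y → (value x ≟ value y) →-dec ¬? (overlined? y)) λs

χ : Part → ℕ
χ x = if overlined x then 1 else 0

-- x and y are consecutive parts, x preceding y. In an overpartition
-- value y ≤ value x, so _∸_ is the true difference.
DifferenceCondition : Part → Part → Set
DifferenceCondition x y =
    (value x % 6 ∈ 1 ∷ 2 ∷ 3 ∷ 5 ∷ [] × ¬ Overlined x → value x ∸ value y ≥ 4 + χ y)
  × (value x % 6 ∈ 0 ∷ 4 ∷ []                         → value x ∸ value y ≥ 5 + χ y)
  × (value x % 6 ∈ 1 ∷ 5 ∷ [] × Overlined x           → value x ∸ value y ≥ 6 + χ y)

differenceCondition? : ∀ x y → Dec (DifferenceCondition x y)
differenceCondition? x y =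
  (((value x % 6) ∈? (1 ∷ 2 ∷ 3 ∷ 5 ∷ []) ×-dec ¬? (overlined? x))
    →-dec (value x ∸ value y ≥? 4 + χ y))
  ×-dec
  (((value x % 6) ∈? (0 ∷ 4 ∷ []))
    →-dec (value x ∸ value y ≥? 5 + χ y))
  ×-dec
  (((value x % 6) ∈? (1 ∷ 5 ∷ []) ×-dec overlined? x)
    →-dec (value x ∸ value y ≥? 6 + χ y))

plain≡₃? : (rs : List ℕ) → Decidable (λ x → ¬ Overlined x × value x % 3 ∈ rs)
plain≡₃? rs x = ¬? (overlined? x) ×-dec (value x % 3) ∈? rs

overlined≡₆? : (r : ℕ) → Decidable (λ x → Overlined x × value x % 6 ≡ r)
overlined≡₆? r x = overlined? x ×-dec value x % 6 ≟ r

InD₃ : ℕ → ℕ → ℕ → List Part → Set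
InD₃ u v n λs =
    IsOverpartition n λs
  × All (λ x → Overlined x → value x % 6 ∈ 1 ∷ 5 ∷ []) λs
  × part 1 true ∉ λs
  × u ≡ #[ plain≡₃? (0 ∷ 1 ∷ []) ] λs + 2 * #[ overlined≡₆? 5 ] λs
  × v ≡ #[ plain≡₃? (0 ∷ 2 ∷ []) ] λs + 2 * #[ overlined≡₆? 1 ] λs
  × Linked DifferenceCondition λs

inD₃? : ∀ u v n → Decidable (InD₃ u v n)
inD₃? u v n λs =
  isOverpartition? n λs
  ×-dec all? (λ x → overlined? x →-dec (value x % 6) ∈? (1 ∷ 5 ∷ [])) λs
  ×-dec ¬? (DecMembership._∈?_ _≟ᴾ_ (part 1 true) λs)
  ×-dec u ≟ _
  ×-dec v ≟ _
  ×-dec linked? differenceCondition? λs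

partsUpTo : ℕ → List Part
partsUpTo n = cartesianProductWith part (upTo (suc n)) (false ∷ true ∷ [])

D₃ : ℕ → ℕ → ℕ → ℕ
D₃ u v n = #[ inD₃? u v n ] (listsOver (partsUpTo n) n)

-- C₃ and D₃ are the cardinalities of the sets InC₃ and InD₃: the finite
-- enumerations above are exhaustive and free of repetitions.

∈-listsOver : {as : List A} (k : ℕ) {xs : List A} →
              All (_∈ as) xs → length xs ≤ k → xs ∈ listsOver as k
∈-listsOver zero    []         z≤n     = here refl
∈-listsOver (suc k) []         z≤n     = here refl
∈-listsOver (suc k) (p ∷ ps)   (s≤s q) =
  there (∈-cartesianProductWith⁺ _∷_ p (∈-listsOver k ps q))

[]∉cons : (as : List A) (xss : List (List A)) →
          All (λ (ys : List A) → ¬ [] ≡ ys) (cartesianProductWith _∷_ as xss)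
[]∉cons []       xss = []
[]∉cons (a ∷ as) xss =
  AllP.++⁺ (AllP.map⁺ (All.universal (λ _ ()) xss)) ([]∉cons as xss)

listsOver-unique : {as : List A} → Unique as → ∀ k → Unique (listsOver as k)
listsOver-unique         u zero    = [] ∷ []
listsOver-unique {as = as} u (suc k) =
  []∉cons as (listsOver as k)
  ∷ UniqueP.cartesianProductWith⁺ _∷_ ∷-injective u (listsOver-unique u k)

filter-size : {P : A → Set} (P? : Decidable P) {xs : List A} → Unique xs →
              (∀ x → P x → x ∈ xs) → HasSize P (#[ P? ] xs)
filter-size P? {xs} u complete =
  filter P? xs , UniqueP.filter⁺ P? u ,
  (λ x → mk⇔ (proj₂ ∘ ∈-filter⁻ P? {xs = xs})
             (λ Px → ∈-filter⁺ P? (complete x Px) Px)) ,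
  refl

length≤sum : ∀ {xs} → All (0 <_) xs → length xs ≤ sum xs
length≤sum []       = z≤n
length≤sum (p ∷ ps) = +-mono-≤ p (length≤sum ps)

all≤sum : ∀ xs → All (_≤ sum xs) xs
all≤sum []       = []
all≤sum (x ∷ xs) =
  m≤m+n x (sum xs) ∷ All.map (λ p → ≤-trans p (m≤n+m (sum xs) x)) (all≤sum xs)

partition-bounds : ∀ {n xs} → IsPartition n xs → All (_≤ n) xs × length xs ≤ n
partition-bounds {xs = xs} (_ , pos , refl) = all≤sum xs , length≤sum pos

C₃-size : ∀ u v n → HasSize (InC₃ u v n) (C₃ u v n)
C₃-size u v n =
  filter-size (inC₃? u v n) (listsOver-unique (UniqueP.upTo⁺ (suc n)) n)
    λ { xs (p , _) → let (b , l) = partition-bounds p in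
        ∈-listsOver n (All.map (λ q → ∈-upTo⁺ (s≤s q)) b) l }

∈-partsUpTo : ∀ {n} (x : Part) → value x ≤ n → x ∈ partsUpTo n
∈-partsUpTo (part m false) p = ∈-cartesianProductWith⁺ part (∈-upTo⁺ (s≤s p)) (here refl)
∈-partsUpTo (part m true)  p = ∈-cartesianProductWith⁺ part (∈-upTo⁺ (s≤s p)) (there (here refl))

partsUpTo-unique : ∀ n → Unique (partsUpTo n)
partsUpTo-unique n =
  UniqueP.cartesianProductWith⁺ part (λ { refl → refl , refl })
    (UniqueP.upTo⁺ (suc n)) (((λ ()) ∷ []) ∷ [] ∷ [])

D₃-size : ∀ u v n → HasSize (InD₃ u v n) (D₃ u v n)
D₃-size u v n =
  filter-size (inD₃? u v n) (listsOver-unique (partsUpTo-unique n) n)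
    λ { xs ((p , _) , _) → let (b , l) = partition-bounds p in
        ∈-listsOver n (All.map (λ {x} → ∈-partsUpTo x) (AllP.map⁻ b))
                      (subst (_≤ n) (length-map value xs) l) }

{-# OPTIONS --safe #-}
module Submission where

-- Let G_n(a, b) be the generating function of the overpartitions counted by D₃
-- whose largest part is at most n, a part with an overline counting as one
-- larger: a marks u, b marks v, and q marks the sum. Removing the largest part
-- gives a recurrence for G_n depending on n modulo 6, and an induction on n in
-- steps of 6 shows G_{6k+6}(a, b) = (1 + aq) G_{6k+4}(bq, aq²). The product of
-- (1 + aq^{3i+1})(1 + bq^{3i+2}), which generates the partitions counted by C₃,
-- satisfies the same functional equation in the limit, and the equation has
-- only one solution with constant term 1.
--
-- All of this is done for natural numbers a, b and q, modulo a power of q;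
-- the coefficients are recovered by Kronecker substitution.

open import Defs
open import Data.Bool using (true; false; if_then_else_)
open import Data.List using (List; []; _∷_; _++_; map; length; filter)
open import Data.List.Properties using (length-filter; length-map; map-++; map-∘; map-cong; ∷-injectiveʳ)
open import Data.List.Membership.Propositional using (_∈_; _∉_)
open import Data.List.Membership.Propositional.Properties
  using (∈-map⁺; ∈-map⁻; ∈-++⁺ˡ; ∈-++⁺ʳ; ∈-++⁻; ∈-filter⁺; ∈-filter⁻)
open import Data.List.Membership.Propositional.Properties.WithK using (unique∧set⇒bag)
open import Data.List.Relation.Binary.BagAndSetEquality using (∼bag⇒↭)
open import Data.List.Relation.Binary.Disjoint.Propositional using (Disjoint)
open import Data.List.Relation.Binary.Permutation.Propositional.Properties using (↭-length)
open import Data.List.Relation.Unary.All as All using (All; []; _∷_)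
import Data.List.Relation.Unary.All.Properties as AllP
open import Data.List.Relation.Unary.AllPairs as AllPairs using ([]; _∷_)
open import Data.List.Relation.Unary.Any using (here; there)
open import Data.List.Relation.Unary.Linked as Linked using (Linked; []; [-]; _∷_)
import Data.List.Relation.Unary.Linked.Properties as LinkedP
open import Data.List.Relation.Unary.Unique.Propositional using (Unique)
import Data.List.Relation.Unary.Unique.Propositional.Properties as UniqueP
open import Data.Nat
open import Data.Nat.Divisibility
  using (_∣_; _∣0; divides; ∣m⇒∣m*n; ∣n⇒∣m*n; *-pres-∣; ∣m∣n⇒∣m+n; ∣-trans; ∣-refl)
open import Data.Nat.DivMod using (m%n<n; [m+kn]%n≡m%n; m<n⇒m%n≡m; m∣n⇒o%n%m≡o%m)
open import Data.Nat.ListAction using (sum)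
open import Data.Nat.ListAction.Properties using (sum-++)
open import Data.Nat.Properties
open import Data.Nat.Tactic.RingSolver using (solve-∀)
open import Data.Product using (∃; _×_; _,_; proj₁; proj₂)
open import Data.Product.Properties using (≡-dec)
open import Data.Sum using (_⊎_; inj₁; inj₂)
open import Function using (_∘_; id; _⇔_; mk⇔; Equivalence)
open import Function.Construct.Composition using (_⇔-∘_)
open import Function.Construct.Symmetry using (⇔-sym)
open import Relation.Binary.Definitions using (DecidableEquality)
open import Relation.Binary.PropositionalEquality
open import Relation.Nullary using (¬_; contradiction)
open import Relation.Nullary.Decidable using (Dec; does; yes; no; does-⇔; _×-dec_; ¬?)
open import Relation.Unary using (Decidable)

private
  variable
    A : Set
    P Q : A → Set
    c d x y z : ℕ

-- Congruences and Kronecker substitution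

infix 4 _≈_[mod_]

-- Multiples of d are added on both sides because subtraction of naturals truncates. For d = 0 the
-- relation is equality, so the modulus `q ^ M` causes no trouble at q = 0.
data _≈_[mod_] (x y d : ℕ) : Set where
  by : ∀ s t → x + d * s ≡ y + d * t → x ≈ y [mod d ]

≈-reflexive : x ≡ y → x ≈ y [mod d ]
≈-reflexive x≡y = by 0 0 (cong (_+ _) x≡y)

≈-sym : x ≈ y [mod d ] → y ≈ x [mod d ]
≈-sym (by s t eq) = by t s (sym eq)

≈-trans : x ≈ y [mod d ] → y ≈ z [mod d ] → x ≈ z [mod d ]
≈-trans {x} {y} {d} {z} (by s t p) (by s′ t′ p′) = by (s + s′) (t′ + t) (begin
  x + d * (s + s′)      ≡⟨ lem x d s s′ ⟩
  x + d * s + d * s′    ≡⟨ cong (_+ d * s′) p ⟩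
  y + d * t + d * s′    ≡⟨ lem′ y d t s′ ⟩
  y + d * s′ + d * t    ≡⟨ cong (_+ d * t) p′ ⟩
  z + d * t′ + d * t    ≡⟨ lem z d t′ t ⟨
  z + d * (t′ + t)      ∎)
  where
  open ≡-Reasoning
  lem : ∀ x d s s′ → x + d * (s + s′) ≡ x + d * s + d * s′
  lem = solve-∀
  lem′ : ∀ y d t s′ → y + d * t + d * s′ ≡ y + d * s′ + d * t
  lem′ = solve-∀

≈-*ˡ : ∀ c → x ≈ y [mod d ] → c * x ≈ c * y [mod d ]
≈-*ˡ {x} {y} {d} c (by s t eq) = by (c * s) (c * t)
  (trans (lem c x d s) (trans (cong (c *_) eq) (sym (lem c y d t))))
  where
  lem : ∀ c x d s → c * x + d * (c * s) ≡ c * (x + d * s)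
  lem = solve-∀

≈-+-∣ : x ≈ y [mod d ] → d ∣ c → x + c ≈ y [mod d ]
≈-+-∣ {x} {y} {d} (by s t eq) (divides r refl) = by s (t + r)
  (trans (lem x r d s) (trans (cong (_+ d * r) eq) (lem′ y d t r)))
  where
  lem : ∀ x r d s → x + r * d + d * s ≡ x + d * s + d * r
  lem = solve-∀
  lem′ : ∀ y d t r → y + d * t + d * r ≡ y + d * (t + r)
  lem′ = solve-∀

≈-weaken : c ∣ d → x ≈ y [mod d ] → x ≈ y [mod c ]
≈-weaken {c} {x = x} {y} (divides r refl) (by s t eq) = by (r * s) (r * t)
  (trans (lem x r c s) (trans eq (sym (lem y r c t))))
  where
  lem : ∀ x r c s → x + c * (r * s) ≡ x + r * c * s
  lem = solve-∀

digit-unique : ∀ B {u u′ w w′} → u < B → u′ < B → u + B * w ≡ u′ + B * w′ → u ≡ u′ × w ≡ w′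
digit-unique B@(suc _) {u} {u′} {w} {w′} u<B u′<B eq = u≡u′ , w≡w′
  where
  mod : ∀ u w → u < B → (u + B * w) % B ≡ u
  mod u w u<B = trans (cong (λ z → (u + z) % B) (*-comm B w)) (trans ([m+kn]%n≡m%n u w B) (m<n⇒m%n≡m u<B))
  u≡u′ : u ≡ u′
  u≡u′ = trans (sym (mod u w u<B)) (trans (cong (_% B) eq) (mod u′ w′ u′<B))
  w≡w′ : w ≡ w′
  w≡w′ = *-cancelˡ-≡ w w′ B (+-cancelˡ-≡ u _ _ (trans eq (cong (_+ B * w′) (sym u≡u′))))

^-mono-∣ : ∀ q {m n} → m ≤ n → q ^ m ∣ q ^ n
^-mono-∣ q {m} {n} m≤n = divides (q ^ (n ∸ m))
  (trans (cong (q ^_) (sym (m∸n+n≡m m≤n))) (^-distribˡ-+-* q (n ∸ m) m))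

powerSum : ℕ → List ℕ → ℕ
powerSum B es = sum (map (B ^_) es)

-- Dropping the zero exponents and decrementing the others removes the lowest base-B digit of
-- `powerSum B` and divides the rest by B.
lowered : List ℕ → List ℕ
lowered []           = []
lowered (zero  ∷ es) = lowered es
lowered (suc e ∷ es) = e ∷ lowered es

length-lowered : ∀ es → length (lowered es) ≤ length es
length-lowered []           = z≤n
length-lowered (zero  ∷ es) = m≤n⇒m≤1+n (length-lowered es)
length-lowered (suc e ∷ es) = s≤s (length-lowered es)

powerSum-lowered : ∀ B es → powerSum B es ≡ #[ _≟ 0 ] es + B * powerSum B (lowered es)
powerSum-lowered B []           = sym (*-zeroʳ B)
powerSum-lowered B (zero  ∷ es) = cong suc (powerSum-lowered B es)
powerSum-lowered B (suc e ∷ es) = begin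
  B * B ^ e + powerSum B es                     ≡⟨ cong (B * B ^ e +_) (powerSum-lowered B es) ⟩
  B * B ^ e + (n + B * powerSum B (lowered es)) ≡⟨ lem B (B ^ e) n (powerSum B (lowered es)) ⟩
  n + B * (B ^ e + powerSum B (lowered es))     ∎
  where
  open ≡-Reasoning
  n = #[ _≟ 0 ] es
  lem : ∀ B p n s → B * p + (n + B * s) ≡ n + B * (p + s)
  lem = solve-∀

count-lowered : ∀ e es → #[ _≟ suc e ] es ≡ #[ _≟ e ] (lowered es)
count-lowered e []            = refl
count-lowered e (zero   ∷ es) = count-lowered e es
count-lowered e (suc e′ ∷ es) with does (e′ ≟ e)
... | true  = cong suc (count-lowered e es)
... | false = count-lowered e es

-- The multiplicities are the base-B digits of the power sums.
powerSum-count : ∀ B e es fs → length es < B → length fs < B →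
                 powerSum B es ≈ powerSum B fs [mod B ^ suc e ] →
                 #[ _≟ e ] es ≡ #[ _≟ e ] fs
powerSum-count B e es fs es<B fs<B (by s t eq) = go e eq
  where
  eq′ : ∀ e s t → powerSum B es + B ^ suc e * s ≡ powerSum B fs + B ^ suc e * t →
        #[ _≟ 0 ] es ≡ #[ _≟ 0 ] fs ×
        powerSum B (lowered es) + B ^ e * s ≡ powerSum B (lowered fs) + B ^ e * t
  eq′ e s t eq = digit-unique B
    (≤-<-trans (length-filter (_≟ 0) es) es<B) (≤-<-trans (length-filter (_≟ 0) fs) fs<B)
    (trans (sym (split es s)) (trans eq (split fs t)))
    where
    lem : ∀ n B p P s → n + B * p + B * P * s ≡ n + B * (p + P * s)
    lem = solve-∀
    split : ∀ es s → powerSum B es + B ^ suc e * s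
                     ≡ #[ _≟ 0 ] es + B * (powerSum B (lowered es) + B ^ e * s)
    split es s = trans (cong (_+ B ^ suc e * s) (powerSum-lowered B es)) (lem _ B _ (B ^ e) s)
  go : ∀ e → powerSum B es + B ^ suc e * s ≡ powerSum B fs + B ^ suc e * t →
       #[ _≟ e ] es ≡ #[ _≟ e ] fs
  go zero    eq = proj₁ (eq′ 0 s t eq)
  go (suc e) eq = begin
    #[ _≟ suc e ] es        ≡⟨ count-lowered e es ⟩
    #[ _≟ e ] (lowered es)  ≡⟨ powerSum-count B e (lowered es) (lowered fs)
                                 (≤-<-trans (length-lowered es) es<B)
                                 (≤-<-trans (length-lowered fs) fs<B)
                                 (by s t (proj₂ (eq′ (suc e) s t eq))) ⟩
    #[ _≟ e ] (lowered fs)  ≡⟨ count-lowered e fs ⟨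
    #[ _≟ suc e ] fs        ∎
    where open ≡-Reasoning

count-map : {B : Set} {P : B → Set} {Q : A → Set} (P? : Decidable P) (Q? : Decidable Q) (f : A → B) →
            ∀ {xs} → All (λ x → P (f x) ⇔ Q x) xs → #[ P? ] (map f xs) ≡ #[ Q? ] xs
count-map P? Q? f [] = refl
count-map P? Q? f {x ∷ xs} (p ∷ ps) rewrite does-⇔ p (P? (f x)) (Q? x) with does (Q? x)
... | true  = cong suc (count-map P? Q? f ps)
... | false = count-map P? Q? f ps

-- Weights and their encoding as exponents.

Weight : Set
Weight = ℕ × ℕ × ℕ

_≟ᵂ_ : DecidableEquality Weight
_≟ᵂ_ = ≡-dec _≟_ (≡-dec _≟_ _≟_)

monomial : (a b q : ℕ) → Weight → ℕ
monomial a b q (u , v , n) = a ^ u * b ^ v * q ^ n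

genfun : (a b q : ℕ) → List Weight → ℕ
genfun a b q ws = sum (map (monomial a b q) ws)

encode : ℕ → Weight → ℕ
encode K (u , v , n) = u + K * (v + K * n)

monomial-encode : ∀ B K w → monomial B (B ^ K) (B ^ (K * K)) w ≡ B ^ encode K w
monomial-encode B K (u , v , n) = begin
  B ^ u * (B ^ K) ^ v * (B ^ (K * K)) ^ n
    ≡⟨ cong₂ (λ y z → B ^ u * y * z) (^-*-assoc B K v) (^-*-assoc B (K * K) n) ⟩
  B ^ u * B ^ (K * v) * B ^ (K * K * n)    ≡⟨ cong (_* B ^ (K * K * n)) (^-distribˡ-+-* B u (K * v)) ⟨
  B ^ (u + K * v) * B ^ (K * K * n)        ≡⟨ ^-distribˡ-+-* B (u + K * v) (K * K * n) ⟨
  B ^ (u + K * v + K * K * n)              ≡⟨ cong (B ^_) (lem u v n K) ⟩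
  B ^ (u + K * (v + K * n))                ∎
  where
  open ≡-Reasoning
  lem : ∀ u v n K → u + K * v + K * K * n ≡ u + K * (v + K * n)
  lem = solve-∀

Bounded : ℕ → Weight → Set
Bounded K (u , v , _) = u < K × v < K

-- Below K, the entries u and v are the two lowest base-K digits of the code; n is what remains
-- above them, so it needs no bound.
encode-injective : ∀ K {w w′} → Bounded K w → Bounded K w′ → encode K w ≡ encode K w′ → w ≡ w′
encode-injective K (u<K , v<K) (u′<K , v′<K) eq
  with refl , eq′ ← digit-unique K u<K u′<K eq
  with refl , refl ← digit-unique K v<K v′<K eq′ = refl

-- Under the substitution `q ^ suc n` becomes B to the power `K * K * suc n`. A congruence modulo
-- that power therefore still fixes the digit at position `encode K (u , v , n)`.
encode-< : ∀ K {u v} n → Bounded K (u , v , n) → encode K (u , v , n) < K * K * suc n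
encode-< K {u} {v} n (u<K , v<K) = begin-strict
  u + K * (v + K * n)     <⟨ +-monoˡ-< (K * (v + K * n)) u<K ⟩
  K + K * (v + K * n)     ≡⟨ lem K v n ⟩
  K * (suc v + K * n)     ≤⟨ *-monoʳ-≤ K (+-monoˡ-≤ (K * n) v<K) ⟩
  K * (K + K * n)         ≡⟨ lem′ K n ⟩
  K * K * suc n           ∎
  where
  open ≤-Reasoning
  lem : ∀ K v n → K + K * (v + K * n) ≡ K * (suc v + K * n)
  lem = solve-∀
  lem′ : ∀ K n → K * (K + K * n) ≡ K * K * suc n
  lem′ = solve-∀

-- Any common strict bound on the u and v would do; a sum is easier to handle than a maximum.
weightBound : List Weight → ℕ
weightBound []                 = 1
weightBound ((u , v , _) ∷ ws) = suc u + suc v + weightBound ws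

weightBound-bounded : ∀ ws → All (Bounded (weightBound ws)) ws
weightBound-bounded []                 = []
weightBound-bounded ((u , v , n) ∷ ws) =
  (≤-trans (m≤m+n (suc u) (suc v)) (m≤m+n _ _) , ≤-trans (m≤n+m (suc v) (suc u)) (m≤m+n _ _))
  ∷ All.map (λ (p , q) → ≤-trans p (m≤n+m _ _) , ≤-trans q (m≤n+m _ _)) (weightBound-bounded ws)

-- Kronecker substitution: for B and K large, the values of the two generating
-- functions at a = B, b = B ^ K, q = B ^ (K * K) determine their coefficients.
genfun-count : ∀ ws ws′ u v n →
               (∀ a b q → genfun a b q ws ≈ genfun a b q ws′ [mod q ^ suc n ]) →
               #[ _≟ᵂ (u , v , n) ] ws ≡ #[ _≟ᵂ (u , v , n) ] ws′
genfun-count ws ws′ u v n approx = begin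
  #[ _≟ᵂ w ] ws                        ≡⟨ recode bws ⟨
  #[ _≟ encode K w ] (map (encode K) ws)   ≡⟨ powerSum-count B (encode K w) (map (encode K) ws) (map (encode K) ws′)
                                             (bound ws (m≤m+n _ _)) (bound ws′ (m≤n+m _ _)) approx′ ⟩
  #[ _≟ encode K w ] (map (encode K) ws′)  ≡⟨ recode bws′ ⟩
  #[ _≟ᵂ w ] ws′                       ∎
  where
  open ≡-Reasoning
  w : Weight
  w = u , v , n
  -- K also bounds the target weight w, so that equality of codes with `encode K w` means equality
  -- with w. B exceeds both lengths, so that multiplicities are base-B digits.
  K = weightBound (w ∷ ws ++ ws′)
  B = suc (length ws + length ws′)
  bound : ∀ (ws″ : List Weight) → length ws″ ≤ length ws + length ws′ → length (map (encode K) ws″) < B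
  bound ws″ p = s≤s (subst (_≤ _) (sym (length-map (encode K) ws″)) p)
  bounded : All (Bounded K) (w ∷ ws ++ ws′)
  bounded = weightBound-bounded (w ∷ ws ++ ws′)
  bws  = AllP.++⁻ˡ ws (All.tail bounded)
  bws′ = AllP.++⁻ʳ ws (All.tail bounded)
  recode : ∀ {ws″} → All (Bounded K) ws″ → #[ _≟ encode K w ] (map (encode K) ws″) ≡ #[ _≟ᵂ w ] ws″
  recode = count-map (_≟ encode K w) (_≟ᵂ w) (encode K) ∘
           All.map (λ p → mk⇔ (encode-injective K p (All.head bounded)) (cong (encode K)))
  value-at : ∀ ws″ → genfun B (B ^ K) (B ^ (K * K)) ws″ ≡ powerSum B (map (encode K) ws″)
  value-at ws″ = cong sum (trans (map-cong (monomial-encode B K) ws″) (map-∘ ws″))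
  approx′ : powerSum B (map (encode K) ws) ≈ powerSum B (map (encode K) ws′) [mod B ^ suc (encode K w) ]
  approx′ = ≈-weaken
    (subst (B ^ suc (encode K w) ∣_) (sym (^-*-assoc B (K * K) (suc n)))
      (^-mono-∣ B (encode-< K n (All.head bounded))))
    (subst₂ (_≈_[mod (B ^ (K * K)) ^ suc n ]) (value-at ws) (value-at ws′)
      (approx B (B ^ K) (B ^ (K * K))))

-- Generating functions of enumerations

-- Two repetition-free lists with the same elements are permutations of each other.
size-unique : ∀ {k l} → HasSize P k → HasSize Q l → (∀ x → P x ⇔ Q x) → k ≡ l
size-unique (xs , xs! , ∈xs , refl) (ys , ys! , ∈ys , refl) P⇔Q =
  ↭-length (∼bag⇒↭ (unique∧set⇒bag xs! ys! λ {x} → ⇔-sym (∈ys x) ⇔-∘ (P⇔Q x ⇔-∘ ∈xs x)))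

prependIf : {P : Set} → Dec P → A → List (List A) → List (List A)
prependIf P? x xss = if does P? then map (x ∷_) xss else []

module _ {P : Set} {x : A} {xss : List (List A)} where

  prependIf-yes : (P? : Dec P) → P → prependIf P? x xss ≡ map (x ∷_) xss
  prependIf-yes (yes _) _ = refl
  prependIf-yes (no ¬p) p = contradiction p ¬p

  prependIf-no : (P? : Dec P) → ¬ P → prependIf P? x xss ≡ []
  prependIf-no (yes p) ¬p = contradiction p ¬p
  prependIf-no (no _)  _  = refl

  ∈-prependIf⁺ : (P? : Dec P) → P → ∀ {xs} → xs ∈ xss → (x ∷ xs) ∈ prependIf P? x xss
  ∈-prependIf⁺ (yes _) _ xs∈ = ∈-map⁺ (x ∷_) xs∈
  ∈-prependIf⁺ (no ¬p) p xs∈ = contradiction p ¬p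

  ∈-prependIf⁻ : (P? : Dec P) → ∀ {ys} → ys ∈ prependIf P? x xss → P × ∃ λ xs → xs ∈ xss × ys ≡ x ∷ xs
  ∈-prependIf⁻ (yes p) ys∈ = p , ∈-map⁻ (x ∷_) ys∈
  ∈-prependIf⁻ (no _)  ()

  prependIf-unique : (P? : Dec P) → Unique xss → Unique (prependIf P? x xss)
  prependIf-unique (yes _) xss! = UniqueP.map⁺ ∷-injectiveʳ xss!
  prependIf-unique (no _)  xss! = []

infixl 6 _+ᵂ_

_+ᵂ_ : Weight → Weight → Weight
(u , v , n) +ᵂ (u′ , v′ , n′) = u + u′ , v + v′ , n + n′

Additive : (List A → Weight) → Set
Additive f = ∀ x xs → f (x ∷ xs) ≡ f (x ∷ []) +ᵂ f xs

count-∷ : (P? : Decidable P) → ∀ x xs → #[ P? ] (x ∷ xs) ≡ #[ P? ] (x ∷ []) + #[ P? ] xs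
count-∷ P? x xs with does (P? x)
... | true  = refl
... | false = refl

module _ (a b q : ℕ) where

  monomial-+ᵂ : ∀ w w′ → monomial a b q (w +ᵂ w′) ≡ monomial a b q w * monomial a b q w′
  monomial-+ᵂ (u , v , n) (u′ , v′ , n′)
    rewrite ^-distribˡ-+-* a u u′ | ^-distribˡ-+-* b v v′ | ^-distribˡ-+-* q n n′
    = lem (a ^ u) (a ^ u′) (b ^ v) (b ^ v′) (q ^ n) (q ^ n′)
    where
    lem : ∀ a a′ b b′ q q′ → a * a′ * (b * b′) * (q * q′) ≡ a * b * q * (a′ * b′ * q′)
    lem = solve-∀

  genfun-++ : ∀ ws ws′ → genfun a b q (ws ++ ws′) ≡ genfun a b q ws + genfun a b q ws′
  genfun-++ ws ws′ = trans (cong sum (map-++ (monomial a b q) ws ws′)) (sum-++ (map (monomial a b q) ws) _)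

  module _ {f : List A → Weight} (f-additive : Additive f) where

    genfun-prepend : ∀ x xss → genfun a b q (map f (map (x ∷_) xss))
                               ≡ monomial a b q (f (x ∷ [])) * genfun a b q (map f xss)
    genfun-prepend x []         = sym (*-zeroʳ (monomial a b q (f (x ∷ []))))
    genfun-prepend x (xs ∷ xss) = begin
      m (f (x ∷ xs)) + genfun a b q (map f (map (x ∷_) xss))
        ≡⟨ cong₂ _+_ (trans (cong m (f-additive x xs)) (monomial-+ᵂ (f (x ∷ [])) (f xs)))
                     (genfun-prepend x xss) ⟩
      m (f (x ∷ [])) * m (f xs) + m (f (x ∷ [])) * genfun a b q (map f xss)
        ≡⟨ *-distribˡ-+ (m (f (x ∷ []))) _ _ ⟨
      m (f (x ∷ [])) * (m (f xs) + genfun a b q (map f xss)) ∎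
      where
      open ≡-Reasoning
      m = monomial a b q

    genfun-prependIf : {P : Set} (P? : Dec P) → ∀ x xss → genfun a b q (map f (prependIf P? x xss))
      ≡ (if does P? then monomial a b q (f (x ∷ [])) * genfun a b q (map f xss) else 0)
    genfun-prependIf (yes _) x xss = genfun-prepend x xss
    genfun-prependIf (no _)  x xss = refl

-- Functions of a and b that are determined modulo q ^ M: iterating the
-- functional equation makes both arguments divisible by q ^ M.
record ShiftInvariant (q M : ℕ) (X : ℕ → ℕ → ℕ) : Set where
  field
    shift    : ∀ a b → X a b ≈ (1 + a * q) * X (b * q) (a * (q * q)) [mod q ^ M ]
    constant : ∀ {a b} → q ^ M ∣ a → q ^ M ∣ b → X a b ≈ 1 [mod q ^ M ]

shiftInvariant-unique : ∀ {q M X Y} → ShiftInvariant q M X → ShiftInvariant q M Y →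
                        ∀ a b → X a b ≈ Y a b [mod q ^ M ]
shiftInvariant-unique {q} {M} {X} {Y} SX SY = λ a b → go M ≤-refl (1∣ a) (1∣ b)
  where
  module SX = ShiftInvariant SX
  module SY = ShiftInvariant SY
  1∣ : ∀ a → q ^ (M ∸ M) ∣ a
  1∣ a rewrite n∸n≡0 M = divides a (sym (*-identityʳ a))
  -- Here j is the number of applications of the functional equation still to come. Each one raises
  -- the power of q known to divide both arguments by one, and both functions acquire the same
  -- factor `1 + a * q`.
  go : ∀ j → j ≤ M → ∀ {a b} → q ^ (M ∸ j) ∣ a → q ^ (M ∸ j) ∣ b → X a b ≈ Y a b [mod q ^ M ]
  go zero    _   a∣ b∣ = ≈-trans (SX.constant a∣ b∣) (≈-sym (SY.constant a∣ b∣))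
  go (suc j) j<M {a} {b} a∣ b∣ =
    ≈-trans (SX.shift a b) (≈-trans (≈-*ˡ (1 + a * q) (go j (<⇒≤ j<M) b∣′ a∣′)) (≈-sym (SY.shift a b)))
    where
    raise : ∀ {c} → q ^ (M ∸ suc j) ∣ c → q ^ (M ∸ j) ∣ c * q
    raise {c} c∣ rewrite +-∸-assoc 1 j<M = subst (_∣ c * q) (*-comm _ q) (*-pres-∣ c∣ ∣-refl)
    b∣′ : q ^ (M ∸ j) ∣ b * q
    b∣′ = raise b∣
    a∣′ : q ^ (M ∸ j) ∣ a * (q * q)
    a∣′ = subst (q ^ (M ∸ j) ∣_) (*-assoc a q q) (∣m⇒∣m*n q (raise a∣))

-- Partitions into distinct parts

unit₃? : Decidable (λ x → x % 3 ∈ 1 ∷ 2 ∷ [])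
unit₃? x = (x % 3) ∈? (1 ∷ 2 ∷ [])

distinctLists : ℕ → List (List ℕ)
distinctLists zero    = [] ∷ []
distinctLists (suc n) = distinctLists n ++ prependIf (unit₃? (suc n)) (suc n) (distinctLists n)

-- The sentinel `suc n` in front of the list bounds all parts by n without a separate condition.
DistinctUpTo : ℕ → List ℕ → Set
DistinctUpTo n xs = Linked _>_ (suc n ∷ xs) × All (λ x → x % 3 ∈ 1 ∷ 2 ∷ []) xs

>-raise : ∀ {n xs} → Linked _>_ (n ∷ xs) → Linked _>_ (suc n ∷ xs)
>-raise [-]        = [-]
>-raise (x<n ∷ xs) = m≤n⇒m≤1+n x<n ∷ xs

∈-distinctLists⁺ : ∀ n {xs} → DistinctUpTo n xs → xs ∈ distinctLists n
∈-distinctLists⁺ zero    {[]}     _                 = here refl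
∈-distinctLists⁺ zero    {0 ∷ _} (_ , here () ∷ _)
∈-distinctLists⁺ zero    {0 ∷ _} (_ , there (here ()) ∷ _)
∈-distinctLists⁺ zero    {0 ∷ _} (_ , there (there ()) ∷ _)
∈-distinctLists⁺ zero    {suc _ ∷ _} (s≤s () ∷ _ , _)
∈-distinctLists⁺ (suc n) {[]}     _                 = ∈-++⁺ˡ (∈-distinctLists⁺ n ([-] , []))
∈-distinctLists⁺ (suc n) {x ∷ xs} (s≤s x≤1+n ∷ lk , r ∷ rs) with m≤n⇒m<n∨m≡n x≤1+n
... | inj₁ x<1+n = ∈-++⁺ˡ (∈-distinctLists⁺ n (x<1+n ∷ lk , r ∷ rs))
... | inj₂ refl  = ∈-++⁺ʳ (distinctLists n)
                     (∈-prependIf⁺ (unit₃? (suc n)) r (∈-distinctLists⁺ n (lk , rs)))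

∈-distinctLists⁻ : ∀ n {xs} → xs ∈ distinctLists n → DistinctUpTo n xs
∈-distinctLists⁻ zero    (here refl) = [-] , []
∈-distinctLists⁻ (suc n) xs∈ with ∈-++⁻ (distinctLists n) xs∈
... | inj₁ xs∈ˡ = let lk , rs = ∈-distinctLists⁻ n xs∈ˡ in >-raise lk , rs
... | inj₂ xs∈ʳ with r , ys , ys∈ , refl ← ∈-prependIf⁻ (unit₃? (suc n)) xs∈ʳ
  = let lk , rs = ∈-distinctLists⁻ n ys∈ in ≤-refl ∷ lk , r ∷ rs

distinctLists-unique : ∀ n → Unique (distinctLists n)
distinctLists-unique zero    = [] ∷ []
distinctLists-unique (suc n) =
  UniqueP.++⁺ ih (prependIf-unique (unit₃? (suc n)) ih) disjoint
  where
  ih = distinctLists-unique n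
  disjoint : Disjoint (distinctLists n) (prependIf (unit₃? (suc n)) (suc n) (distinctLists n))
  disjoint (xs∈ , xs∈′) with _ , _ , _ , refl ← ∈-prependIf⁻ (unit₃? (suc n)) xs∈′
    with (1+n<1+n ∷ _) , _ ← ∈-distinctLists⁻ n xs∈ = <-irrefl refl 1+n<1+n

weightᶜ : List ℕ → Weight
weightᶜ xs = #[ (λ x → x % 3 ≟ 1) ] xs , #[ (λ x → x % 3 ≟ 2) ] xs , sum xs

weightᶜ-additive : Additive weightᶜ
weightᶜ-additive x xs =
  cong₂ _,_ (count-∷ _ x xs) (cong₂ _,_ (count-∷ _ x xs) (cong (_+ sum xs) (sym (+-identityʳ x))))

C₃⇔distinctLists : ∀ u v n {N} → n ≤ N → ∀ xs →
                   InC₃ u v n xs ⇔ (xs ∈ distinctLists N × weightᶜ xs ≡ (u , v , n))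
C₃⇔distinctLists u v n {N} n≤N xs = mk⇔ to from
  where
  sentinel : ∀ {xs} → All (_≤ N) xs → Linked _>_ xs → Linked _>_ (suc N ∷ xs)
  sentinel []        _  = [-]
  sentinel (x≤N ∷ _) lk = s≤s x≤N ∷ lk
  to : InC₃ u v n xs → xs ∈ distinctLists N × weightᶜ xs ≡ (u , v , n)
  to (p@(lk , _ , refl) , xs! , rs , refl , refl) =
    ∈-distinctLists⁺ N (sentinel (All.map (λ x≤n → ≤-trans x≤n n≤N) (all≤sum xs)) lk′ , rs) , refl
    where
    -- A non-increasing list without repetitions is strictly decreasing.
    lk′ : Linked _>_ xs
    lk′ = Linked.zipWith (λ (x≥y , x≢y) → ≤∧≢⇒< x≥y (x≢y ∘ sym)) (lk , LinkedP.AllPairs⇒Linked xs!)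
  -- Positivity of the parts comes from the residues: 0 is neither 1 nor 2 modulo 3.
  positive : ∀ {x} → x % 3 ∈ 1 ∷ 2 ∷ [] → 0 < x
  positive {suc _} _ = z<s
  positive {zero}  (here ())
  positive {zero}  (there (here ()))
  positive {zero}  (there (there ()))
  from : xs ∈ distinctLists N × weightᶜ xs ≡ (u , v , n) → InC₃ u v n xs
  from (xs∈ , refl) with lk , rs ← ∈-distinctLists⁻ N xs∈ =
    (Linked.map <⇒≤ lk′ , All.map positive rs , refl)
    , AllPairs.map (λ x>y x≡y → <⇒≢ x>y (sym x≡y)) (LinkedP.Linked⇒AllPairs (λ p q → <-trans q p) lk′)
    , rs , refl , refl
    where
    lk′ : Linked _>_ xs
    lk′ = Linked.tail lk

-- The product formula for partitions into distinct parts.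

mod₃ : ∀ r k → (r + k * 3) % 3 ≡ r % 3
mod₃ r k = [m+kn]%n≡m%n r k 3

module _ (q : ℕ) where

  private
    -- By `distinctLists-step` this is the truncated product of `(1 + a * q ^ (1 + i * 3)) * (1 + b
    -- * q ^ (2 + i * 3))` over i < k.
    F : ℕ → ℕ → ℕ → ℕ
    F k a b = genfun a b q (map weightᶜ (distinctLists (k * 3)))

  distinctLists-suc : ∀ a b n → genfun a b q (map weightᶜ (distinctLists (suc n)))
    ≡ genfun a b q (map weightᶜ (distinctLists n))
      + (if does (unit₃? (suc n))
         then monomial a b q (weightᶜ (suc n ∷ [])) * genfun a b q (map weightᶜ (distinctLists n)) else 0)
  distinctLists-suc a b n
    rewrite map-++ weightᶜ (distinctLists n) (prependIf (unit₃? (suc n)) (suc n) (distinctLists n))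
    = trans (genfun-++ a b q (map weightᶜ (distinctLists n)) _)
        (cong (genfun a b q (map weightᶜ (distinctLists n)) +_)
          (genfun-prependIf a b q weightᶜ-additive (unit₃? (suc n)) (suc n) (distinctLists n)))

  -- Of the three new values, the multiple of 3 is rejected by `unit₃?`; each of the other two is
  -- either absent or the largest part, which gives one factor.
  distinctLists-step : ∀ a b k → F (suc k) a b ≡ F k a b * (1 + a * q ^ (1 + k * 3)) * (1 + b * q ^ (2 + k * 3))
  distinctLists-step a b k
    rewrite distinctLists-suc a b (2 + k * 3) | distinctLists-suc a b (1 + k * 3) | distinctLists-suc a b (k * 3)
          | mod₃ 1 k | mod₃ 2 k | mod₃ 3 k | +-identityʳ (k * 3)
    = lem a b (F k a b) (q ^ (1 + k * 3)) (q ^ (2 + k * 3))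
    where
    lem : ∀ a b p r s →
      let p₁ = p + a * 1 * 1 * r * p in
      p₁ + 1 * (b * 1) * s * p₁ + 0 ≡ p * (1 + a * r) * (1 + b * s)
    lem = solve-∀

  -- Replacing (a, b) by (bq, aq²) turns the first factor at i into the second factor at i, and the
  -- second factor at i into the first factor at i + 1. Only `1 + a * q` is then missing at the
  -- bottom, and there is one surplus factor at the top, which stands on the left.
  distinctLists-shift : ∀ a b k →
    F k a b * (1 + a * q ^ (1 + k * 3)) ≡ (1 + a * q) * F k (b * q) (a * (q * q))
  distinctLists-shift a b zero = lem a q
    where
    lem : ∀ a q → 1 * (1 + a * (q * 1)) ≡ (1 + a * q) * 1
    lem = solve-∀
  distinctLists-shift a b (suc k) = begin
    F (suc k) a b * (1 + a * q ^ (4 + k * 3))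
      ≡⟨ cong (_* (1 + a * q ^ (4 + k * 3))) (distinctLists-step a b k) ⟩
    F k a b * (1 + a * q ^ (1 + k * 3)) * (1 + b * q ^ (2 + k * 3)) * (1 + a * q ^ (4 + k * 3))
      ≡⟨ cong (λ y → y * (1 + b * q ^ (2 + k * 3)) * (1 + a * q ^ (4 + k * 3))) (distinctLists-shift a b k) ⟩
    (1 + a * q) * F′ * (1 + b * q ^ (2 + k * 3)) * (1 + a * q ^ (4 + k * 3))
      ≡⟨ lem a b q F′ (q ^ (1 + k * 3)) ⟩
    (1 + a * q) * (F′ * (1 + b * q * q ^ (1 + k * 3)) * (1 + a * (q * q) * q ^ (2 + k * 3)))
      ≡⟨ cong ((1 + a * q) *_) (distinctLists-step (b * q) (a * (q * q)) k) ⟨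
    (1 + a * q) * F (suc k) (b * q) (a * (q * q)) ∎
    where
    open ≡-Reasoning
    F′ = F k (b * q) (a * (q * q))
    lem : ∀ a b q p r → (1 + a * q) * p * (1 + b * (q * r)) * (1 + a * (q * (q * (q * r))))
      ≡ (1 + a * q) * (p * (1 + b * q * r) * (1 + a * (q * q) * (q * r)))
    lem = solve-∀

  distinctLists-constant : ∀ {d a b} → d ∣ a → d ∣ b → ∀ k → F k a b ≈ 1 [mod d ]
  distinctLists-constant d∣a d∣b zero = ≈-reflexive refl
  distinctLists-constant {a = a} {b} d∣a d∣b (suc k) =
    ≈-trans (≈-reflexive (trans (distinctLists-step a b k) (lem a b (F k a b) _ _)))
      (≈-+-∣ (≈-+-∣ (distinctLists-constant d∣a d∣b k) (∣m⇒∣m*n _ d∣a)) (∣m⇒∣m*n _ d∣b))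
    where
    lem : ∀ a b p r s → p * (1 + a * r) * (1 + b * s) ≡ p + a * (r * p) + b * (p * (1 + a * r) * s)
    lem = solve-∀

  -- The surplus factor `1 + a * q ^ (1 + k * 3)` is 1 modulo `q ^ M`.
  distinctLists-shiftInvariant : ∀ {M} k → M ≤ 1 + k * 3 → ShiftInvariant q M (F k)
  distinctLists-shiftInvariant {M} k M≤ = record
    { shift    = λ a b → ≈-trans
        (≈-sym (≈-+-∣ (≈-reflexive refl)
          (∣-trans (^-mono-∣ q M≤) (∣n⇒∣m*n (F k a b * a) ∣-refl))))
        (≈-reflexive (trans (lem a (F k a b) _) (distinctLists-shift a b k)))
    ; constant = λ a∣ b∣ → distinctLists-constant a∣ b∣ k
    }
    where
    lem : ∀ a p r → p + p * a * r ≡ p * (1 + a * r)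
    lem = solve-∀

-- Enumeration of the overpartitions

residue₆-cases : ∀ r → r < 6 → r ∈ 1 ∷ 2 ∷ 3 ∷ 5 ∷ [] ⊎ r ∈ 0 ∷ 4 ∷ []
residue₆-cases 0 _ = inj₂ (here refl)
residue₆-cases 1 _ = inj₁ (here refl)
residue₆-cases 2 _ = inj₁ (there (here refl))
residue₆-cases 3 _ = inj₁ (there (there (here refl)))
residue₆-cases 4 _ = inj₂ (there (here refl))
residue₆-cases 5 _ = inj₁ (there (there (there (here refl))))
residue₆-cases (suc (suc (suc (suc (suc (suc _)))))) (s≤s (s≤s (s≤s (s≤s (s≤s (s≤s ()))))))

-- One less than the required difference, since the recursion in `chains` has already gone from
-- `suc n` down to n when the skip is applied.
plainSkip : ℕ → ℕ
plainSkip 0 = 4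
plainSkip 4 = 4
plainSkip _ = 3

plainSkip-3 : ∀ {r} → r ∈ 1 ∷ 2 ∷ 3 ∷ 5 ∷ [] → plainSkip r ≡ 3
plainSkip-3 (here refl)                         = refl
plainSkip-3 (there (here refl))                 = refl
plainSkip-3 (there (there (here refl)))         = refl
plainSkip-3 (there (there (there (here refl)))) = refl

plainSkip-4 : ∀ {r} → r ∈ 0 ∷ 4 ∷ [] → plainSkip r ≡ 4
plainSkip-4 (here refl)         = refl
plainSkip-4 (there (here refl)) = refl

04∩15-empty : ∀ {r} → r ∈ 0 ∷ 4 ∷ [] → r ∉ 1 ∷ 5 ∷ []
04∩15-empty (here refl)         (there (there ()))
04∩15-empty (there (here refl)) (there (there ()))

gap : Part → ℕ
gap (part m false) = suc (plainSkip (m % 6))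
gap (part m true)  = 6

-- The difference condition bounds the rank of the part that follows.
rank : Part → ℕ
rank p = χ p + value p

Admissible : Part → Set
Admissible p = 0 < value p × (Overlined p → value p % 6 ∈ 1 ∷ 5 ∷ []) × p ≢ part 1 true

-- For a plain x exactly one of the first two clauses applies, according to the residue modulo 6. An
-- admissible overlined x has residue 1 or 5, which leaves the third clause only.
difference⇔gap : ∀ {x} y → Admissible x → DifferenceCondition x y ⇔ (gap x + χ y ≤ value x ∸ value y)
difference⇔gap {part m false} y _ = mk⇔ to from
  where
  to : DifferenceCondition (part m false) y → suc (plainSkip (m % 6)) + χ y ≤ m ∸ value y
  to (low , high , _) with residue₆-cases (m % 6) (m%n<n m 6)
  ... | inj₁ r∈ rewrite plainSkip-3 r∈ = low (r∈ , λ ())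
  ... | inj₂ r∈ rewrite plainSkip-4 r∈ = high r∈
  from : suc (plainSkip (m % 6)) + χ y ≤ m ∸ value y → DifferenceCondition (part m false) y
  from le = (λ (r∈ , _) → subst (λ s → suc s + χ y ≤ m ∸ value y) (plainSkip-3 r∈) le)
          , (λ r∈ → subst (λ s → suc s + χ y ≤ m ∸ value y) (plainSkip-4 r∈) le)
          , λ ()
difference⇔gap {part m true} y (_ , over , _) = mk⇔ (λ (_ , _ , third) → third (over _ , _))
  (λ le → (λ (_ , ¬over) → contradiction _ ¬over) , (λ r∈ → contradiction (over _) (04∩15-empty r∈)) , λ _ → le)

gap-positive : ∀ x → 0 < gap x
gap-positive (part _ false) = z<s
gap-positive (part _ true)  = z<s

Follows : Part → Part → Set
Follows x y = rank y ≤ value x ∸ gap x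

gap⇒follows : ∀ x y → gap x + χ y ≤ value x ∸ value y → Follows x y
gap⇒follows x y le = m+n≤o⇒m≤o∸n (rank y) (begin
  χ y + value y + gap x    ≡⟨ lem (χ y) (value y) (gap x) ⟩
  gap x + χ y + value y    ≤⟨ m≤o∸n⇒m+n≤o (gap x + χ y) vy≤vx le ⟩
  value x                  ∎)
  where
  open ≤-Reasoning
  lem : ∀ a b c → a + b + c ≡ c + a + b
  lem = solve-∀
  -- Otherwise the truncated difference would be 0, below the positive gap.
  vy≤vx : value y ≤ value x
  vy≤vx = <⇒≤ (m∸n≢0⇒n<m λ eq →
    <⇒≱ (gap-positive x) (≤-trans (m≤m+n (gap x) (χ y)) (subst (gap x + χ y ≤_) eq le)))

-- A positive y has positive rank, so `value x ∸ gap x` is positive and the subtraction has not been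
-- truncated.
follows-gap≤ : ∀ x y → 0 < value y → Follows x y → gap x ≤ value x
follows-gap≤ x y vy>0 f = <⇒≤ (m∸n≢0⇒n<m λ eq →
  <⇒≱ vy>0 (≤-trans (m≤n+m (value y) (χ y)) (subst (rank y ≤_) eq f)))

follows⇒gap : ∀ x y → 0 < value y → Follows x y → gap x + χ y ≤ value x ∸ value y
follows⇒gap x y vy>0 f = m+n≤o⇒m≤o∸n (gap x + χ y) (begin
  gap x + χ y + value y    ≡⟨ lem (χ y) (value y) (gap x) ⟨
  χ y + value y + gap x    ≤⟨ m≤o∸n⇒m+n≤o (rank y) (follows-gap≤ x y vy>0 f) f ⟩
  value x                  ∎)
  where
  open ≤-Reasoning
  lem : ∀ a b c → a + b + c ≡ c + a + b
  lem = solve-∀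

follows⇒> : ∀ x y → 0 < value y → Follows x y → value y < value x
follows⇒> x y vy>0 f = begin-strict
  value y          ≤⟨ m≤n+m (value y) (χ y) ⟩
  rank y           ≤⟨ f ⟩
  value x ∸ gap x  <⟨ ∸-monoʳ-< (gap-positive x) (follows-gap≤ x y vy>0 f) ⟩
  value x          ∎
  where open ≤-Reasoning

-- The index bounds the rank of the first part; each part sets the bound for the next one. This
-- makes the difference condition follow the recursion of `chains`.
data Chain : ℕ → List Part → Set where
  []   : ∀ {n} → Chain n []
  cons : ∀ {n p ps} → Admissible p → rank p ≤ n → Chain (value p ∸ gap p) ps → Chain n (p ∷ ps)

chain-mono : ∀ {m n ps} → m ≤ n → Chain m ps → Chain n ps
chain-mono m≤n []              = []
chain-mono m≤n (cons ok le ch) = cons ok (≤-trans le m≤n) ch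

chain⇒linked : ∀ {n ps} → Chain n ps → All Admissible ps × Linked Follows ps
chain⇒linked []                                = [] , []
chain⇒linked (cons ok _ [])                    = ok ∷ [] , [-]
chain⇒linked (cons ok _ ch@(cons _ f _)) = let oks , lk = chain⇒linked ch in ok ∷ oks , f ∷ lk

linked⇒chain : ∀ {n ps} → All Admissible ps → Linked Follows ps → All (λ p → rank p ≤ n) ps → Chain n ps
linked⇒chain []         _  _        = []
linked⇒chain (ok ∷ [])  _  (le ∷ _) = cons ok le []
linked⇒chain (ok ∷ oks@(_ ∷ _)) (f ∷ lk) (le ∷ _) = cons ok le (follow oks lk f)
  where
  follow : ∀ {m p ps} → All Admissible (p ∷ ps) → Linked Follows (p ∷ ps) → rank p ≤ m → Chain m (p ∷ ps)
  follow (ok ∷ [])          _        le = cons ok le []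
  follow (ok ∷ oks@(_ ∷ _)) (f ∷ lk) le = cons ok le (follow oks lk f)

-- An overlined part of value n has rank `suc n`. Hence `chains (suc n)` introduces the overlined n
-- together with the plain `suc n`, and tests n here.
Barred : ℕ → Set
Barred n = n % 6 ∈ 1 ∷ 5 ∷ [] × n ≢ 1

barred? : Decidable Barred
barred? n = ((n % 6) ∈? (1 ∷ 5 ∷ [])) ×-dec ¬? (n ≟ 1)

-- chains n s lists the chains of rank at most n ∸ s; the second argument
-- keeps the recursion structural.
chains : ℕ → ℕ → List (List Part)
chains zero    _       = [] ∷ []
chains (suc n) (suc s) = chains n s
chains (suc n) zero    =
  chains n 0 ++ (map (part (suc n) false ∷_) (chains n (plainSkip (suc n % 6)))
                 ++ prependIf (barred? n) (part n true) (chains n 6))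

chains-∸ : ∀ n s → chains n s ≡ chains (n ∸ s) 0
chains-∸ zero    zero    = refl
chains-∸ zero    (suc s) = refl
chains-∸ (suc n) zero    = refl
chains-∸ (suc n) (suc s) = chains-∸ n s

barred⇒admissible : ∀ {n} → Barred n → Admissible (part n true)
barred⇒admissible {suc _} (r , n≢1) = z<s , (λ _ → r) , λ { refl → n≢1 refl }
barred⇒admissible {zero}  (there (there ()) , _)

∈-chains⁻ : ∀ n s {ps} → ps ∈ chains n s → Chain (n ∸ s) ps
∈-chains⁻ zero    s       (here refl) = []
∈-chains⁻ (suc n) (suc s) ps∈ = ∈-chains⁻ n s ps∈
∈-chains⁻ (suc n) zero    ps∈ with ∈-++⁻ (chains n 0) ps∈
... | inj₁ ps∈ˡ = chain-mono (n≤1+n n) (∈-chains⁻ n 0 ps∈ˡ)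
... | inj₂ ps∈ʳ with ∈-++⁻ (map (part (suc n) false ∷_) (chains n (plainSkip (suc n % 6)))) ps∈ʳ
...   | inj₁ ps∈ᵐ with qs , qs∈ , refl ← ∈-map⁻ (part (suc n) false ∷_) ps∈ᵐ
  = cons (z<s , (λ ()) , λ ()) ≤-refl (∈-chains⁻ n (plainSkip (suc n % 6)) qs∈)
...   | inj₂ ps∈ᵇ with bar , qs , qs∈ , refl ← ∈-prependIf⁻ (barred? n) ps∈ᵇ
  = cons (barred⇒admissible bar) ≤-refl (∈-chains⁻ n 6 qs∈)

∈-chains⁺ : ∀ n s {ps} → Chain (n ∸ s) ps → ps ∈ chains n s
∈-chains⁺ zero    s       []             = here refl
∈-chains⁺ zero    s       (cons {p = part (suc m) false} _ le _) =
  contradiction (subst (suc m ≤_) (0∸n≡0 s) le) λ ()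
∈-chains⁺ zero    s       (cons {p = part m true} _ le _) =
  contradiction (subst (suc m ≤_) (0∸n≡0 s) le) λ ()
∈-chains⁺ (suc n) (suc s) ch = ∈-chains⁺ n s ch
∈-chains⁺ (suc n) zero    [] = ∈-++⁺ˡ (∈-chains⁺ n 0 [])
-- Either the first part has rank at most n, or its rank is exactly `suc n`, which makes it the
-- plain `suc n` or the overlined n.
∈-chains⁺ (suc n) zero    (cons {p = p} ok le ch) with m≤n⇒m<n∨m≡n le
... | inj₁ (s≤s lt) = ∈-++⁺ˡ (∈-chains⁺ n 0 (cons ok lt ch))
∈-chains⁺ (suc n) zero    (cons {p = part _ false} ok le ch) | inj₂ refl =
  ∈-++⁺ʳ (chains n 0) (∈-++⁺ˡ (∈-map⁺ (part (suc n) false ∷_) (∈-chains⁺ n (plainSkip (suc n % 6)) ch)))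
∈-chains⁺ (suc n) zero    (cons {p = part _ true} (_ , over , ≢1) le ch) | inj₂ refl =
  ∈-++⁺ʳ (chains n 0) (∈-++⁺ʳ (map (part (suc n) false ∷_) (chains n (plainSkip (suc n % 6))))
    (∈-prependIf⁺ (barred? n) (over _ , λ { refl → ≢1 refl }) (∈-chains⁺ n 6 ch)))

-- The first part tells the three pieces apart: its rank, if the chain is nonempty, is at most n in
-- the first piece and `suc n` in the others, which differ in the overline.
chains-unique : ∀ n s → Unique (chains n s)
chains-unique zero    s       = [] ∷ []
chains-unique (suc n) (suc s) = chains-unique n s
chains-unique (suc n) zero    =
  UniqueP.++⁺ (chains-unique n 0)
    (UniqueP.++⁺ (UniqueP.map⁺ ∷-injectiveʳ (chains-unique n (plainSkip (suc n % 6))))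
                 (prependIf-unique (barred? n) (chains-unique n 6)) plain≢bar)
    low≢high
  where
  plains = map (part (suc n) false ∷_) (chains n (plainSkip (suc n % 6)))
  bars   = prependIf (barred? n) (part n true) (chains n 6)
  plain≢bar : Disjoint plains bars
  plain≢bar (ps∈ , ps∈′) with _ , _ , refl ← ∈-map⁻ (part (suc n) false ∷_) ps∈
    with _ , _ , _ , () ← ∈-prependIf⁻ (barred? n) ps∈′
  low≢high : Disjoint (chains n 0) (plains ++ bars)
  low≢high (ps∈ , ps∈′) with ∈-chains⁻ n 0 ps∈ | ∈-++⁻ plains ps∈′
  ... | ch | inj₁ ps∈ᵐ with _ , _ , refl ← ∈-map⁻ (part (suc n) false ∷_) ps∈ᵐ
    with cons _ 1+n≤n _ ← ch = <-irrefl refl 1+n≤n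
  ... | ch | inj₂ ps∈ᵇ with _ , _ , _ , refl ← ∈-prependIf⁻ (barred? n) ps∈ᵇ
    with cons _ 1+n≤n _ ← ch = <-irrefl refl 1+n≤n

weightᴰ : List Part → Weight
weightᴰ ps = #[ plain≡₃? (0 ∷ 1 ∷ []) ] ps + 2 * #[ overlined≡₆? 5 ] ps
           , #[ plain≡₃? (0 ∷ 2 ∷ []) ] ps + 2 * #[ overlined≡₆? 1 ] ps
           , sum (map value ps)

weightᴰ-additive : Additive weightᴰ
weightᴰ-additive p ps = cong₂ _,_ (both (plain≡₃? (0 ∷ 1 ∷ [])) (overlined≡₆? 5))
  (cong₂ _,_ (both (plain≡₃? (0 ∷ 2 ∷ [])) (overlined≡₆? 1))
             (cong (_+ sum (map value ps)) (sym (+-identityʳ (value p)))))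
  where
  lem : ∀ a b c d → a + b + 2 * (c + d) ≡ a + 2 * c + (b + 2 * d)
  lem = solve-∀
  both : {P Q : Part → Set} (P? : Decidable P) (Q? : Decidable Q) →
    #[ P? ] (p ∷ ps) + 2 * #[ Q? ] (p ∷ ps)
    ≡ #[ P? ] (p ∷ []) + 2 * #[ Q? ] (p ∷ []) + (#[ P? ] ps + 2 * #[ Q? ] ps)
  both P? Q? rewrite count-∷ P? p ps | count-∷ Q? p ps =
    lem (#[ P? ] (p ∷ [])) (#[ P? ] ps) (#[ Q? ] (p ∷ [])) (#[ Q? ] ps)

-- N must reach `suc n` because an overlined part of value n has rank `suc n`.
D₃⇔chains : ∀ u v n {N} → suc n ≤ N → ∀ ps →
            InD₃ u v n ps ⇔ (ps ∈ chains N 0 × weightᴰ ps ≡ (u , v , n))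
D₃⇔chains u v n {N} n<N ps = mk⇔ to from
  where
  to : InD₃ u v n ps → ps ∈ chains N 0 × weightᴰ ps ≡ (u , v , n)
  to (((_ , pos , refl) , _) , over , 1∉ , refl , refl , diff) =
    ∈-chains⁺ N 0 (linked⇒chain oks (follow oks diff)
      (All.map (λ {p} le → ≤-trans (rank≤ p) (≤-trans (s≤s le) n<N)) (AllP.map⁻ (all≤sum (map value ps))))) , refl
    where
    rank≤ : ∀ p → rank p ≤ suc (value p)
    rank≤ (part m false) = n≤1+n m
    rank≤ (part m true)  = ≤-refl
    admissible : ∀ {ps} → All (0 <_) (map value ps) →
      All (λ x → Overlined x → value x % 6 ∈ 1 ∷ 5 ∷ []) ps → part 1 true ∉ ps → All Admissible ps
    admissible {[]}    _ _ _ = []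
    admissible {_ ∷ _} (p ∷ ps) (o ∷ os) 1∉ = (p , o , (λ eq → 1∉ (here (sym eq)))) ∷ admissible ps os (1∉ ∘ there)
    oks = admissible pos over 1∉
    follow : ∀ {ps} → All Admissible ps → Linked DifferenceCondition ps → Linked Follows ps
    follow _ []  = []
    follow _ [-] = [-]
    follow (ok ∷ oks) (_∷_ {x = x} {y = y} d ds) =
      gap⇒follows x y (Equivalence.to (difference⇔gap y ok) d) ∷ follow oks ds
  from : ps ∈ chains N 0 × weightᴰ ps ≡ (u , v , n) → InD₃ u v n ps
  from (ps∈ , refl) =
    ( ( LinkedP.map⁺ (Linked.map (λ (gt , _) → <⇒≤ gt) lk)
      , AllP.map⁺ (All.map proj₁ oks) , refl)
    -- Consecutive values are strictly decreasing, so equal neighbours are contradictory.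
    , Linked.map (λ (gt , _) eq → contradiction (sym eq) (<⇒≢ gt)) lk)
    , All.map (λ ok → proj₁ (proj₂ ok)) oks
    , (λ 1∈ → proj₂ (proj₂ (All.lookup oks 1∈)) refl)
    , refl , refl , Linked.map proj₂ lk
    where
    oks = proj₁ (chain⇒linked (∈-chains⁻ N 0 ps∈))
    differ : ∀ {ps} → All Admissible ps → Linked Follows ps →
             Linked (λ x y → value y < value x × DifferenceCondition x y) ps
    differ _ []  = []
    differ _ [-] = [-]
    differ (ok ∷ oks@((vy>0 , _) ∷ _)) (_∷_ {x = x} {y = y} f fs) =
      (follows⇒> x y vy>0 f , Equivalence.from (difference⇔gap y ok) (follows⇒gap x y vy>0 f)) ∷ differ oks fs
    lk = differ oks (proj₂ (chain⇒linked (∈-chains⁻ N 0 ps∈)))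

-- The functional equation for overpartitions

-- One equation per residue of the largest rank modulo 6. The terms with `b * b` and `a * a` come
-- from overlined parts congruent to 1 and 5; `g₂-zero` lacks such a term because the overlined 1 is
-- excluded. At k = 0 the truncated indices `n ∸ 3` and `n ∸ 1` refer to g 0.
record SixTermRecurrence (a b q : ℕ) (g : ℕ → ℕ) : Set where
  field
    g₀ : g 0 ≡ 1
    g₁ : ∀ k → let n = k * 6 in g (1 + n) ≡ g n + a * q ^ (1 + n) * g (n ∸ 3)
    g₂-zero : g 2 ≡ g 1 + b * q ^ 2 * g 0
    g₂-suc : ∀ k → let n = k * 6 in
      g (8 + n) ≡ g (7 + n) + (b * q ^ (8 + n) * g (4 + n) + b * b * q ^ (7 + n) * g (1 + n))
    g₃ : ∀ k → let n = k * 6 in g (3 + n) ≡ g (2 + n) + a * b * q ^ (3 + n) * g (n ∸ 1)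
    g₄ : ∀ k → let n = k * 6 in g (4 + n) ≡ g (3 + n) + a * q ^ (4 + n) * g (n ∸ 1)
    g₅ : ∀ k → let n = k * 6 in g (5 + n) ≡ g (4 + n) + b * q ^ (5 + n) * g (1 + n)
    g₆ : ∀ k → let n = k * 6 in
      g (6 + n) ≡ g (5 + n) + (a * b * q ^ (6 + n) * g (1 + n) + a * a * q ^ (5 + n) * g (n ∸ 1))

module _ {a b q : ℕ} {g h : ℕ → ℕ}
         (G : SixTermRecurrence a b q g) (H : SixTermRecurrence (b * q) (a * (q * q)) q h) where
  private
    module G = SixTermRecurrence G
    module H = SixTermRecurrence H

  -- Only shift₆ is wanted; the other identities make the induction on k close.
  record ShiftIdentities (k : ℕ) : Set where
    private n = k * 6
    field
      shift₄ : g (4 + n) + a * q * g (5 + n) ≡ (1 + a * q) * (h (3 + n) + a * q * h (1 + n))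
      shift₅ : g (5 + n) ≡ h (4 + n) + a * q * h (1 + n)
      shift₆ : g (6 + n) ≡ (1 + a * q) * h (4 + n)
      shift₇ : g (7 + n) ≡ (1 + a * q) * h (5 + n)
      shift₉ : g (9 + n) ≡ (1 + a * q) * h (7 + n)

  open ShiftIdentities

  module Step (k : ℕ) (I : ShiftIdentities k) where
    n = k * 6

    -- Unfolding both sides with the recurrences and the identities for k leaves a polynomial
    -- identity in h at 7 + n, 5 + n, 4 + n and 1 + n. The same holds for `s₁₀` and `s₁₂`.
    s₁₁ : g (11 + n) ≡ h (10 + n) + a * q * h (7 + n)
    s₁₁ rewrite G.g₅ (suc k) | G.g₄ (suc k) | H.g₄ (suc k) | H.g₃ (suc k) | H.g₂-suc k
         | shift₉ I | shift₇ I | shift₅ I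
         = lem a b q (q ^ (7 + n)) (h (7 + n)) (h (5 + n)) (h (4 + n)) (h (1 + n))
      where
      lem : ∀ a b q r h₇ h₅ h₄ h₁ →
        let c = 1 + a * q in
        c * h₇ + a * (q * (q * (q * r))) * (h₄ + a * q * h₁) + b * (q * (q * (q * (q * r)))) * (c * h₅)
        ≡ h₇ + (a * (q * q) * (q * r) * h₄ + a * (q * q) * (a * (q * q)) * r * h₁)
          + b * q * (a * (q * q)) * (q * (q * r)) * h₅ + b * q * (q * (q * (q * r))) * h₅
          + a * q * h₇
      lem = solve-∀

    s₁₀ : g (10 + n) + a * q * g (11 + n) ≡ (1 + a * q) * (h (9 + n) + a * q * h (7 + n))
    s₁₀ rewrite s₁₁ | G.g₄ (suc k) | H.g₄ (suc k) | H.g₃ (suc k) | H.g₂-suc k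
         | shift₉ I | shift₅ I
         = lem a b q (q ^ (7 + n)) (h (7 + n)) (h (5 + n)) (h (4 + n)) (h (1 + n))
      where
      lem : ∀ a b q r h₇ h₅ h₄ h₁ →
        let c = 1 + a * q
            h₈ = h₇ + (a * (q * q) * (q * r) * h₄ + a * (q * q) * (a * (q * q)) * r * h₁)
            h₉ = h₈ + b * q * (a * (q * q)) * (q * (q * r)) * h₅
        in
        c * h₇ + a * (q * (q * (q * r))) * (h₄ + a * q * h₁)
          + a * q * (h₉ + b * q * (q * (q * (q * r))) * h₅ + a * q * h₇)
        ≡ c * (h₉ + a * q * h₇)
      lem = solve-∀

    s₁₂ : g (12 + n) ≡ (1 + a * q) * h (10 + n)
    s₁₂ rewrite G.g₆ (suc k) | G.g₅ (suc k) | G.g₄ (suc k) | H.g₄ (suc k) | H.g₃ (suc k) | H.g₂-suc k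
         | shift₉ I | shift₇ I | shift₅ I
         = lem a b q (q ^ (7 + n)) (h (7 + n)) (h (5 + n)) (h (4 + n)) (h (1 + n))
      where
      lem : ∀ a b q r h₇ h₅ h₄ h₁ →
        let c = 1 + a * q
            g₅ = h₄ + a * q * h₁
            g₇ = c * h₅
        in
        c * h₇ + a * (q * (q * (q * r))) * g₅ + b * (q * (q * (q * (q * r)))) * g₇
          + (a * b * (q * (q * (q * (q * (q * r))))) * g₇ + a * a * (q * (q * (q * (q * r)))) * g₅)
        ≡ c * (h₇ + (a * (q * q) * (q * r) * h₄ + a * (q * q) * (a * (q * q)) * r * h₁)
          + b * q * (a * (q * q)) * (q * (q * r)) * h₅ + b * q * (q * (q * (q * r))) * h₅)
      lem = solve-∀

    s₁₃ : g (13 + n) ≡ (1 + a * q) * h (11 + n)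
    s₁₃ rewrite G.g₁ (2 + k) | s₁₂ | H.g₅ (suc k) | shift₉ I
         = lem a q (q ^ (11 + n)) (h (10 + n)) (h (7 + n))
      where
      lem : ∀ a q r h₁₀ h₇ → let c = 1 + a * q in
        c * h₁₀ + a * (q * (q * r)) * (c * h₇) ≡ c * (h₁₀ + a * (q * q) * r * h₇)
      lem = solve-∀

    -- The plain parts 14 + n and 15 + n together contribute a multiple of
    -- `g (10 + n) + a * q * g (11 + n)`. This is the combination evaluated by `s₁₀`, and it
    -- explains the form of `shift₄`.
    s₁₅ : g (15 + n) ≡ (1 + a * q) * h (13 + n)
    s₁₅ = begin
      g (15 + n)
        ≡⟨ G.g₃ (2 + k) ⟩
      g (14 + n) + a * b * q ^ (15 + n) * g (11 + n)
        ≡⟨ cong (_+ a * b * q ^ (15 + n) * g (11 + n)) (G.g₂-suc (suc k)) ⟩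
      g (13 + n) + (b * q ^ (14 + n) * g (10 + n) + b * b * q ^ (13 + n) * g (7 + n))
        + a * b * q ^ (15 + n) * g (11 + n)
        ≡⟨ collect a b q (q ^ (13 + n)) (g (13 + n)) (g (7 + n)) (g (10 + n)) (g (11 + n)) ⟩
      g (13 + n) + b * b * q ^ (13 + n) * g (7 + n)
        + b * q ^ (14 + n) * (g (10 + n) + a * q * g (11 + n))
        ≡⟨ cong₂ (λ y z → y + b * q ^ (14 + n) * z)
             (cong₂ (λ y z → y + b * b * q ^ (13 + n) * z) s₁₃ (shift₇ I)) s₁₀ ⟩
      (1 + a * q) * h (11 + n) + b * b * q ^ (13 + n) * ((1 + a * q) * h (5 + n))
        + b * q ^ (14 + n) * ((1 + a * q) * (h (9 + n) + a * q * h (7 + n)))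
        ≡⟨ distribute a b q (q ^ (11 + n)) (h (11 + n)) (h (9 + n)) (h (7 + n)) (h (5 + n)) ⟩
      (1 + a * q) * (h (11 + n) + (b * q * (a * (q * q)) * q ^ (12 + n) * h (7 + n)
        + b * q * (b * q) * q ^ (11 + n) * h (5 + n)) + b * q * q ^ (13 + n) * h (9 + n))
        -- The bracket is now the recurrence for h at 13 + n with h at 12 + n expanded; the last two
        -- steps fold it back.
        ≡⟨ cong (λ y → (1 + a * q) * (y + b * q * q ^ (13 + n) * h (9 + n))) (H.g₆ (suc k)) ⟨
      (1 + a * q) * (h (12 + n) + b * q * q ^ (13 + n) * h (9 + n))
        ≡⟨ cong ((1 + a * q) *_) (H.g₁ (2 + k)) ⟨
      (1 + a * q) * h (13 + n) ∎
      where
      open ≡-Reasoning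
      collect : ∀ a b q r g₁₃ g₇ g₁₀ g₁₁ →
        g₁₃ + (b * (q * r) * g₁₀ + b * b * r * g₇) + a * b * (q * (q * r)) * g₁₁
        ≡ g₁₃ + b * b * r * g₇ + b * (q * r) * (g₁₀ + a * q * g₁₁)
      collect = solve-∀
      distribute : ∀ a b q r h₁₁ h₉ h₇ h₅ → let c = 1 + a * q in
        c * h₁₁ + b * b * (q * (q * r)) * (c * h₅)
          + b * (q * (q * (q * r))) * (c * (h₉ + a * q * h₇))
        ≡ c * (h₁₁ + (b * q * (a * (q * q)) * (q * r) * h₇ + b * q * (b * q) * r * h₅)
          + b * q * (q * (q * r)) * h₉)
      distribute = solve-∀

  -- The first few values of g and h are computed as explicit polynomials in a, b and q and then
  -- compared.
  shift-base : ShiftIdentities 0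
  shift-base = record { shift₄ = b₄ ; shift₅ = b₅ ; shift₆ = b₆ ; shift₇ = b₇ ; shift₉ = b₉ }
    where
    g1 : g 1 ≡ 1 + a * q
    g1 rewrite G.g₁ 0 | G.g₀ = lem a q where
      lem : ∀ a q → 1 + a * (q * 1) * 1 ≡ 1 + a * q
      lem = solve-∀
    g3 : g 3 ≡ (1 + a * q) * (1 + b * q ^ 2)
    g3 rewrite G.g₃ 0 | G.g₂-zero | g1 | G.g₀ = lem a b q where
      lem : ∀ a b q → 1 + a * q + b * (q * (q * 1)) * 1 + a * b * (q * (q * (q * 1))) * 1
            ≡ (1 + a * q) * (1 + b * (q * (q * 1)))
      lem = solve-∀
    g4 : g 4 ≡ (1 + a * q) * (1 + b * q ^ 2) + a * q ^ 4
    g4 rewrite G.g₄ 0 | g3 | G.g₀ = cong ((1 + a * q) * (1 + b * q ^ 2) +_) (*-identityʳ _)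
    g5 : g 5 ≡ (1 + a * q) * (1 + b * q ^ 2) + a * q ^ 4 + b * q ^ 5 * (1 + a * q)
    g5 rewrite G.g₅ 0 | g4 | g1 = refl
    h1 : h 1 ≡ 1 + b * q ^ 2
    h1 rewrite H.g₁ 0 | H.g₀ = lem b q where
      lem : ∀ b q → 1 + b * q * (q * 1) * 1 ≡ 1 + b * (q * (q * 1))
      lem = solve-∀
    h3 : h 3 ≡ (1 + b * q ^ 2) * (1 + a * q ^ 4)
    h3 rewrite H.g₃ 0 | H.g₂-zero | h1 | H.g₀ = lem a b q where
      lem : ∀ a b q → 1 + b * (q * (q * 1)) + a * (q * q) * (q * (q * 1)) * 1
            + b * q * (a * (q * q)) * (q * (q * (q * 1))) * 1
            ≡ (1 + b * (q * (q * 1))) * (1 + a * (q * (q * (q * (q * 1)))))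
      lem = solve-∀
    h4 : h 4 ≡ (1 + b * q ^ 2) * (1 + a * q ^ 4) + b * q ^ 5
    h4 rewrite H.g₄ 0 | h3 | H.g₀ = lem a b q where
      lem : ∀ a b q → let s = (1 + b * (q * (q * 1))) * (1 + a * (q * (q * (q * (q * 1))))) in
        s + b * q * (q * (q * (q * (q * 1)))) * 1 ≡ s + b * (q * (q * (q * (q * (q * 1)))))
      lem = solve-∀
    b₄ : g 4 + a * q * g 5 ≡ (1 + a * q) * (h 3 + a * q * h 1)
    b₄ rewrite g5 | g4 | h3 | h1 = lem a b q where
      lem : ∀ a b q → let r = q * (q * 1)
                          t = (1 + a * q) * (1 + b * r) + a * (q * (q * r)) in
        t + a * q * (t + b * (q * (q * (q * r))) * (1 + a * q))
        ≡ (1 + a * q) * ((1 + b * r) * (1 + a * (q * (q * r))) + a * q * (1 + b * r))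
      lem = solve-∀
    b₅ : g 5 ≡ h 4 + a * q * h 1
    b₅ rewrite g5 | h4 | h1 = lem a b q where
      lem : ∀ a b q → let r = q * (q * 1) in
        (1 + a * q) * (1 + b * r) + a * (q * (q * r)) + b * (q * (q * (q * r))) * (1 + a * q)
        ≡ (1 + b * r) * (1 + a * (q * (q * r))) + b * (q * (q * (q * r))) + a * q * (1 + b * r)
      lem = solve-∀
    b₆ : g 6 ≡ (1 + a * q) * h 4
    b₆ rewrite G.g₆ 0 | g5 | h4 | g1 | G.g₀ = lem a b q where
      lem : ∀ a b q → let r = q * (q * 1) in
        (1 + a * q) * (1 + b * r) + a * (q * (q * r)) + b * (q * (q * (q * r))) * (1 + a * q)
        + (a * b * (q * (q * (q * (q * r)))) * (1 + a * q) + a * a * (q * (q * (q * r))) * 1)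
        ≡ (1 + a * q) * ((1 + b * r) * (1 + a * (q * (q * r))) + b * (q * (q * (q * r))))
      lem = solve-∀
    b₇ : g 7 ≡ (1 + a * q) * h 5
    b₇ rewrite G.g₁ 1 | b₆ | g3 | H.g₅ 0 | h1 = lem a b q (q ^ 2) (h 4) where
      lem : ∀ a b q r h₄ → let c = 1 + a * q in
        c * h₄ + a * (q * (q * (q * (q * (q * r))))) * (c * (1 + b * r))
        ≡ c * (h₄ + a * (q * q) * (q * (q * (q * r))) * (1 + b * r))
      lem = solve-∀
    b₉ : g 9 ≡ (1 + a * q) * h 7
    b₉ rewrite G.g₃ 1 | G.g₂-suc 0 | b₇ | g5 | g4 | g1 | H.g₁ 1 | H.g₆ 0 | h3 | h1 | H.g₀
      = lem a b q (h 5) where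
      lem : ∀ a b q h₅ →
        let c = 1 + a * q
            r = q * (q * 1)
            t = c * (1 + b * r) + a * (q * (q * r))
            q⁷ = q * (q * (q * (q * (q * r))))
        in
        c * h₅ + (b * (q * q⁷) * t + b * b * q⁷ * c)
          + a * b * (q * (q * q⁷)) * (t + b * (q * (q * (q * r))) * c)
        ≡ c * (h₅ + (b * q * (a * (q * q)) * (q * (q * (q * (q * r)))) * (1 + b * r)
          + b * q * (b * q) * (q * (q * (q * r))) * 1)
          + b * q * q⁷ * ((1 + b * r) * (1 + a * (q * (q * r)))))
      lem = solve-∀

  shift-identities : ∀ k → ShiftIdentities k
  shift-identities zero = shift-base
  shift-identities (suc k) = record { shift₄ = s₁₀ ; shift₅ = s₁₁ ; shift₆ = s₁₂ ; shift₇ = s₁₃ ; shift₉ = s₁₅ }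
    where open Step k (shift-identities k)

-- The generating function of the chains.

mod₆ : ∀ r k → (r + k * 6) % 6 ≡ r % 6
mod₆ r k = [m+kn]%n≡m%n r k 6

module _ (a b : ℕ) where

  -- The argument is a residue modulo 6. A multiple of 3 counts towards both u and v, hence `a * b`.
  plainCoefficient : ℕ → ℕ
  plainCoefficient 0 = a * b
  plainCoefficient 1 = a
  plainCoefficient 2 = b
  plainCoefficient 3 = a * b
  plainCoefficient 4 = a
  plainCoefficient _ = b

  -- Applied only to residues 1 and 5; the default clause serves residue 1.
  barCoefficient : ℕ → ℕ
  barCoefficient 5 = a * a
  barCoefficient _ = b * b

  module _ {d : ℕ} (d∣a : d ∣ a) (d∣b : d ∣ b) where

    ∣plainCoefficient : ∀ r → d ∣ plainCoefficient r
    ∣plainCoefficient 0 = ∣m⇒∣m*n b d∣a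
    ∣plainCoefficient 1 = d∣a
    ∣plainCoefficient 2 = d∣b
    ∣plainCoefficient 3 = ∣m⇒∣m*n b d∣a
    ∣plainCoefficient 4 = d∣a
    ∣plainCoefficient (suc (suc (suc (suc (suc _))))) = d∣b

    ∣barCoefficient : ∀ {r} → r ∈ 1 ∷ 5 ∷ [] → d ∣ barCoefficient r
    ∣barCoefficient (here refl)         = ∣m⇒∣m*n b d∣b
    ∣barCoefficient (there (here refl)) = ∣m⇒∣m*n a d∣a

module _ (a b q : ℕ) where

  monomial-plain : ∀ m → monomial a b q (weightᴰ (part m false ∷ [])) ≡ plainCoefficient a b (m % 6) * q ^ m
  -- The weight tests m modulo 3, the coefficient is read off modulo 6; the residue modulo 3 is
  -- recovered from the one modulo 6.
  monomial-plain m = go (m % 6) (m%n<n m 6) (sym (m∣n⇒o%n%m≡o%m 3 6 m (divides 2 refl)))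
    where
    ab : ∀ a b r → a * 1 * (b * 1) * r ≡ a * b * r
    ab = solve-∀
    a1 : ∀ a r → a * 1 * 1 * r ≡ a * r
    a1 = solve-∀
    b1 : ∀ b r → 1 * (b * 1) * r ≡ b * r
    b1 = solve-∀
    go : ∀ r → r < 6 → m % 3 ≡ r % 3 →
         monomial a b q (weightᴰ (part m false ∷ [])) ≡ plainCoefficient a b r * q ^ m
    go 0 _ eq rewrite eq | +-identityʳ m = ab a b (q ^ m)
    go 1 _ eq rewrite eq | +-identityʳ m = a1 a (q ^ m)
    go 2 _ eq rewrite eq | +-identityʳ m = b1 b (q ^ m)
    go 3 _ eq rewrite eq | +-identityʳ m = ab a b (q ^ m)
    go 4 _ eq rewrite eq | +-identityʳ m = a1 a (q ^ m)
    go 5 _ eq rewrite eq | +-identityʳ m = b1 b (q ^ m)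
    go (suc (suc (suc (suc (suc (suc _)))))) (s≤s (s≤s (s≤s (s≤s (s≤s (s≤s ())))))) _

  monomial-bar : ∀ m → m % 6 ∈ 1 ∷ 5 ∷ [] →
                 monomial a b q (weightᴰ (part m true ∷ [])) ≡ barCoefficient a b (m % 6) * q ^ m
  monomial-bar m (here eq) rewrite eq | +-identityʳ m = lem b (q ^ m)
    where
    lem : ∀ b r → 1 * (b * (b * 1)) * r ≡ b * b * r
    lem = solve-∀
  monomial-bar m (there (here eq)) rewrite eq | +-identityʳ m = lem a (q ^ m)
    where
    lem : ∀ a r → a * (a * 1) * 1 * r ≡ a * a * r
    lem = solve-∀

  chainsGF : ℕ → ℕ → ℕ
  chainsGF n s = genfun a b q (map weightᴰ (chains n s))

  barTerm : ℕ → ℕ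
  barTerm n = genfun a b q (map weightᴰ (prependIf (barred? n) (part n true) (chains n 6)))

  barTerm-barred : ∀ {n} → Barred n → barTerm n ≡ barCoefficient a b (n % 6) * q ^ n * chainsGF n 6
  barTerm-barred {n} bar = begin
    barTerm n
      ≡⟨ cong (λ pss → genfun a b q (map weightᴰ pss)) (prependIf-yes (barred? n) bar) ⟩
    genfun a b q (map weightᴰ (map (part n true ∷_) (chains n 6)))
      ≡⟨ genfun-prepend a b q {f = weightᴰ} weightᴰ-additive (part n true) (chains n 6) ⟩
    monomial a b q (weightᴰ (part n true ∷ [])) * chainsGF n 6
      ≡⟨ cong (_* chainsGF n 6) (monomial-bar n (proj₁ bar)) ⟩
    barCoefficient a b (n % 6) * q ^ n * chainsGF n 6 ∎
    where open ≡-Reasoning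

  barTerm-¬barred : ∀ {n} → ¬ Barred n → barTerm n ≡ 0
  barTerm-¬barred {n} ¬bar = cong (λ pss → genfun a b q (map weightᴰ pss)) (prependIf-no (barred? n) ¬bar)

  chainsGF-suc : ∀ n → chainsGF (suc n) 0 ≡ chainsGF n 0
    + (plainCoefficient a b (suc n % 6) * q ^ suc n * chainsGF n (plainSkip (suc n % 6)) + barTerm n)
  chainsGF-suc n = begin
    gf (chains n 0 ++ (plains ++ bars))
      ≡⟨ gf-++ (chains n 0) (plains ++ bars) ⟩
    gf (chains n 0) + gf (plains ++ bars)
      ≡⟨ cong (gf (chains n 0) +_) (gf-++ plains bars) ⟩
    gf (chains n 0) + (gf plains + gf bars)
      ≡⟨ cong (λ y → gf (chains n 0) + (y + gf bars))
           (trans (genfun-prepend a b q {f = weightᴰ} weightᴰ-additive (part (suc n) false)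
                                  (chains n (plainSkip (suc n % 6))))
                  (cong (_* chainsGF n (plainSkip (suc n % 6))) (monomial-plain (suc n)))) ⟩
    _ ∎
    where
    open ≡-Reasoning
    plains = map (part (suc n) false ∷_) (chains n (plainSkip (suc n % 6)))
    bars   = prependIf (barred? n) (part n true) (chains n 6)
    gf : List (List Part) → ℕ
    gf pss = genfun a b q (map weightᴰ pss)
    gf-++ : ∀ pss pss′ → gf (pss ++ pss′) ≡ gf pss + gf pss′
    gf-++ pss pss′ = trans (cong (genfun a b q) (map-++ weightᴰ pss pss′))
                           (genfun-++ a b q (map weightᴰ pss) (map weightᴰ pss′))

  -- Every part carries a factor a or b, so modulo a common divisor only the empty chain survives.
  chainsGF-constant : ∀ {d} → d ∣ a → d ∣ b → ∀ n s → chainsGF n s ≈ 1 [mod d ]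
  chainsGF-constant d∣a d∣b zero    s       = ≈-reflexive refl
  chainsGF-constant d∣a d∣b (suc n) (suc s) = chainsGF-constant d∣a d∣b n s
  chainsGF-constant {d} d∣a d∣b (suc n) zero =
    ≈-trans (≈-reflexive (chainsGF-suc n)) (≈-+-∣ (chainsGF-constant d∣a d∣b n 0)
      (∣m∣n⇒∣m+n (∣m⇒∣m*n _ (∣m⇒∣m*n (q ^ suc n) (∣plainCoefficient a b d∣a d∣b (suc n % 6)))) d∣barTerm))
    where
    d∣barTerm : d ∣ barTerm n
    d∣barTerm with barred? n
    ... | yes bar = subst (d ∣_) (sym (barTerm-barred bar))
                      (∣m⇒∣m*n _ (∣m⇒∣m*n (q ^ n) (∣barCoefficient a b d∣a d∣b (proj₁ bar))))
    ... | no ¬bar = subst (d ∣_) (sym (barTerm-¬barred ¬bar)) (d ∣0)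

  G : ℕ → ℕ
  G n = chainsGF n 0

  chainsGF-∸ : ∀ n s → chainsGF n s ≡ G (n ∸ s)
  chainsGF-∸ n s = cong (λ pss → genfun a b q (map weightᴰ pss)) (chains-∸ n s)

  plain-step : ∀ n {r} → suc n % 6 ≡ r → ¬ Barred n →
               G (suc n) ≡ G n + plainCoefficient a b r * q ^ suc n * G (n ∸ plainSkip r)
  plain-step n refl ¬bar = trans (chainsGF-suc n) (cong (G n +_) (trans
    (cong₂ _+_ (cong (plainCoefficient a b (suc n % 6) * q ^ suc n *_) (chainsGF-∸ n (plainSkip (suc n % 6))))
               (barTerm-¬barred ¬bar))
    (+-identityʳ _)))

  bar-step : ∀ n {r s} → suc n % 6 ≡ r → n % 6 ≡ s → Barred n →
             G (suc n) ≡ G n + (plainCoefficient a b r * q ^ suc n * G (n ∸ plainSkip r)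
                                + barCoefficient a b s * q ^ n * G (n ∸ 6))
  bar-step n refl refl bar = trans (chainsGF-suc n) (cong (G n +_)
    (cong₂ _+_ (cong (plainCoefficient a b (suc n % 6) * q ^ suc n *_) (chainsGF-∸ n (plainSkip (suc n % 6))))
               (trans (barTerm-barred bar) (cong (barCoefficient a b (n % 6) * q ^ n *_) (chainsGF-∸ n 6)))))

  chainsGF-recurrence : SixTermRecurrence a b q G
  chainsGF-recurrence = record
    { g₀      = refl
    ; g₁      = λ k → plain-step (k * 6) (mod₆ 1 k) (¬barred k 0 λ { (there (there ())) })
    ; g₂-zero = plain-step 1 refl λ (_ , 1≢1) → 1≢1 refl
    ; g₂-suc  = λ k → bar-step (7 + k * 6) (mod₆ 8 k) (mod₆ 7 k) (here (mod₆ 7 k) , λ ())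
    ; g₃      = λ k → plain-step (2 + k * 6) (mod₆ 3 k) (¬barred k 2 λ { (there (there ())) })
    ; g₄      = λ k → plain-step (3 + k * 6) (mod₆ 4 k) (¬barred k 3 λ { (there (there ())) })
    ; g₅      = λ k → plain-step (4 + k * 6) (mod₆ 5 k) (¬barred k 4 λ { (there (there ())) })
    ; g₆      = λ k → bar-step (5 + k * 6) (mod₆ 6 k) (mod₆ 5 k) (there (here (mod₆ 5 k)) , λ ())
    }
    where
    ¬barred : ∀ k r → r % 6 ∉ 1 ∷ 5 ∷ [] → ¬ Barred (r + k * 6)
    ¬barred k r r∉ (r∈ , _) = r∉ (subst (_∈ 1 ∷ 5 ∷ []) (mod₆ r k) r∈)

-- `shift₆` relates rank 6 + 6k to rank 4 + 6k. The two ranks in between add only multiples of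
-- `q ^ (5 + k * 6)`, so modulo `q ^ M` the same truncation can stand on both sides.
chains-shiftInvariant : ∀ q {M} k → M ≤ 5 + k * 6 → ShiftInvariant q M (λ a b → G a b q (6 + k * 6))
chains-shiftInvariant q {M} k M≤ = record
  { shift    = λ a b → ≈-trans (≈-reflexive (ShiftIdentities.shift₆ (shift-identities (chainsGF-recurrence a b q)
                                  (chainsGF-recurrence (b * q) (a * (q * q)) q) k)))
                         (≈-*ˡ (1 + a * q) (≈-sym (tail (b * q) (a * (q * q)))))
  ; constant = λ {a} {b} a∣ b∣ → chainsGF-constant a b q a∣ b∣ (6 + k * 6) 0
  }
  where
  tail : ∀ a b → G a b q (6 + k * 6) ≈ G a b q (4 + k * 6) [mod q ^ M ]
  tail a b = ≈-weaken (^-mono-∣ q M≤) (≈-trans (≈-reflexive (R.g₆ k))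
      (≈-+-∣ (≈-trans (≈-reflexive (R.g₅ k)) (≈-+-∣ (≈-reflexive refl) (divides-coefficient b (g 1))))
        -- One q of `q ^ (6 + k * 6)` is moved into the coefficient to expose the divisor.
        (∣m∣n⇒∣m+n (subst (q ^ (5 + k * 6) ∣_) (lem (a * b) q _ (g 1)) (divides-coefficient (a * b * q) (g 1)))
                   (divides-coefficient (a * a) _))))
    where
    module R = SixTermRecurrence (chainsGF-recurrence a b q)
    g : ℕ → ℕ
    g r = G a b q (r + k * 6)
    divides-coefficient : ∀ c y → q ^ (5 + k * 6) ∣ c * q ^ (5 + k * 6) * y
    divides-coefficient c y = ∣m⇒∣m*n y (∣n⇒∣m*n c ∣-refl)
    lem : ∀ c q r y → c * q * r * y ≡ c * (q * r) * y
    lem = solve-∀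

-- Comparison of coefficients.

count-weights : (f : A → Weight) (w : Weight) (xs : List A) →
                #[ _≟ᵂ w ] (map f xs) ≡ #[ (λ x → f x ≟ᵂ w) ] xs
count-weights f w xs = count-map (_≟ᵂ w) (λ x → f x ≟ᵂ w) f (All.universal (λ _ → mk⇔ id id) xs)

selection-size : (f : A → Weight) (w : Weight) {xs : List A} → Unique xs →
                 HasSize (λ x → x ∈ xs × f x ≡ w) (#[ (λ x → f x ≟ᵂ w) ] xs)
selection-size f w {xs} xs! = filter f? xs , UniqueP.filter⁺ f? xs!
  , (λ x → mk⇔ (∈-filter⁻ f?) (λ (x∈ , eq) → ∈-filter⁺ f? x∈ eq)) , refl
  where
  f? : Decidable (λ x → f x ≡ w)
  f? x = f x ≟ᵂ w

theorem1p10 : (u v n : ℕ) → C₃ u v n ≡ D₃ u v n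
theorem1p10 u v n = begin
  C₃ u v n
    ≡⟨ size-unique (C₃-size u v n) (selection-size weightᶜ w (distinctLists-unique N₁))
         (C₃⇔distinctLists u v n n≤N₁) ⟩
  #[ (λ xs → weightᶜ xs ≟ᵂ w) ] (distinctLists N₁)
    ≡⟨ count-weights weightᶜ w (distinctLists N₁) ⟨
  #[ _≟ᵂ w ] (map weightᶜ (distinctLists N₁))
    ≡⟨ genfun-count (map weightᶜ (distinctLists N₁)) (map weightᴰ (chains N₂ 0)) u v n (λ a b q →
         shiftInvariant-unique (distinctLists-shiftInvariant q (suc n) n<N₁)
                               (chains-shiftInvariant q n n<N₂) a b) ⟩
  #[ _≟ᵂ w ] (map weightᴰ (chains N₂ 0))
    ≡⟨ count-weights weightᴰ w (chains N₂ 0) ⟩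
  #[ (λ ps → weightᴰ ps ≟ᵂ w) ] (chains N₂ 0)
    ≡⟨ size-unique (D₃-size u v n) (selection-size weightᴰ w (chains-unique N₂ 0))
         (D₃⇔chains u v n (≤-trans n<N₂ (n≤1+n _))) ⟨
  D₃ u v n ∎
  where
  open ≡-Reasoning
  w : Weight
  w = u , v , n
  -- Both bounds are large enough to admit every partition of n and to give the functional equations
  -- modulo `q ^ suc n`. Their shapes are those of `F (suc n)` and of `shift₆` at k = n.
  N₁ = suc n * 3
  N₂ = 6 + n * 6
  n≤N₁ : n ≤ N₁
  n≤N₁ = ≤-trans (n≤1+n n) (m≤m*n (suc n) 3)
  n<N₁ : suc n ≤ 1 + N₁
  n<N₁ = s≤s n≤N₁
  n<N₂ : suc n ≤ 5 + n * 6
  n<N₂ = s≤s (≤-trans (m≤m*n n 6) (m≤n+m (n * 6) 4))
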